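{- Let $d\ge3$ be an integer. The set $\mathfrak P_d\subseteq\mathbb R^{2d-3}$ is an integral polytope (a bounded convex polytope all of whose vertices lie in $\mathbb Z^{2d-3}$) with exactly $3^{d-2}$ vertices.
   Context: $[m]=\{1,\dots,m\}$. $\mathfrak P_d\subseteq\mathbb R^{2d-3}$ is the set of $(x_1,\dots,x_{d-2},y_1,\dots,y_{d-2},z)\in\mathbb R^{2d-3}$ satisfying: $x_j-x_{j+1}\ge0$ and $y_j-y_{j+1}\ge0$ for $j\in[d-3]$; $x_j\ge0$, $y_j\ge0$ for $j\in[d-2]$; $j(z+d-1-j)+\sum_{i=0}^{j-2}x_{d-2-i}-\sum_{i=1}^{j}y_i\ge0$ for $j\in[d-2]$; and $\sum_{i=1}^{d-2}y_i-\sum_{i=1}^{d-2}x_i=z(d-1)$.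
   Formalization: The set $\mathfrak P_d$ is taken over ℚ^(2d-3) instead of $\mathbb R^{2d-3}$, so its boundedness and its vertices refer to rational points. -}

module Defs where

open import Data.Nat as ℕ using (ℕ; zero; suc; _∸_; _<?_)
open import Data.Integer as ℤ using (ℤ; +_)
open import Data.Rational as ℚ using (ℚ; 0ℚ; 1ℚ; _+_; _*_; _-_; _≤_; _<_; ∣_∣)
open import Data.Fin using (Fin; fromℕ<)
open import Data.Product using (_×_; _,_; Σ; ∃)
open import Data.List using (List; length)
open import Data.List.Membership.Propositional using (_∈_)
open import Data.List.Relation.Unary.Any using (Any)
open import Relation.Binary.PropositionalEquality using (_≡_)
open import Relation.Nullary using (¬_; yes; no)

ι : ℕ → ℚ
ι n = (+ n) ℚ./ 1

ιℤ : ℤ → ℚ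
ιℤ k = k ℚ./ 1

-- A point of ℚ^{2d-3}, written (x₁..x_{d-2}, y₁..y_{d-2}, z) with m = d-2;
-- the coordinate x_j (1-indexed) is stored at index j-1.
Point : ℕ → Set
Point m = (Fin m → ℚ) × (Fin m → ℚ) × ℚ

-- 1-indexed access: at v j = v_j for 1 ≤ j ≤ m (value 0 outside; never used there)
at : {m : ℕ} → (Fin m → ℚ) → ℕ → ℚ
at {m} v zero = 0ℚ
at {m} v (suc i) with i <? m
... | yes i<m = v (fromℕ< i<m)
... | no _ = 0ℚ

sumTo : ℕ → (ℕ → ℚ) → ℚ
sumTo zero f = 0ℚ
sumTo (suc n) f = sumTo n f + f n

InP : (d : ℕ) → Point (d ∸ 2) → Set
InP d (x , y , z) =
  (∀ j → 1 ℕ.≤ j → j ℕ.≤ d ∸ 3 → (at x (suc j) ≤ at x j) × (at y (suc j) ≤ at y j))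
  × (∀ j → 1 ℕ.≤ j → j ℕ.≤ d ∸ 2 → (0ℚ ≤ at x j) × (0ℚ ≤ at y j))
  × (∀ j → 1 ℕ.≤ j → j ℕ.≤ d ∸ 2 →
       0ℚ ≤ (ι j * (z + ι (d ∸ 1 ∸ j))
              + sumTo (j ∸ 1) (λ i → at x (d ∸ 2 ∸ i)))
            - sumTo j (λ i → at y (suc i)))
  × (sumTo (d ∸ 2) (λ i → at y (suc i)) - sumTo (d ∸ 2) (λ i → at x (suc i))
       ≡ z * ι (d ∸ 1))

_≈P_ : {m : ℕ} → Point m → Point m → Set
_≈P_ (x , y , z) (x' , y' , z') = (∀ i → x i ≡ x' i) × (∀ i → y i ≡ y' i) × (z ≡ z')

comb : {m : ℕ} → ℚ → Point m → Point m → Point m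
comb t (x , y , z) (x' , y' , z') =
  (λ i → t * x i + (1ℚ - t) * x' i) , (λ i → t * y i + (1ℚ - t) * y' i) , (t * z + (1ℚ - t) * z')

IsVertex : (d : ℕ) → Point (d ∸ 2) → Set
IsVertex d p = InP d p ×
  (∀ q r t → InP d q → InP d r → 0ℚ < t → t < 1ℚ → p ≈P comb t q r → q ≈P r)

Integral : {m : ℕ} → Point m → Set
Integral (x , y , z) =
  (∀ i → ∃ λ k → x i ≡ ιℤ k) × (∀ i → ∃ λ k → y i ≡ ιℤ k) × (∃ λ k → z ≡ ιℤ k)

Bounded : (d : ℕ) → Set
Bounded d = ∃ λ B → ∀ x y z → InP d (x , y , z) →
  (∀ i → ∣ x i ∣ ≤ B) × (∀ i → ∣ y i ∣ ≤ B) × (∣ z ∣ ≤ B)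

data Distinct {m : ℕ} : List (Point m) → Set where
  []  : Distinct Data.List.[]
  _∷_ : ∀ {p ps} → (∀ {q} → q ∈ ps → ¬ (p ≈P q)) → Distinct ps → Distinct (p Data.List.∷ ps)

IntegralPolytopeWithVertices : (d N : ℕ) → Set
IntegralPolytopeWithVertices d N =
  Bounded d ×
  Σ (List (Point (d ∸ 2))) λ vs →
    (length vs ≡ N) × Distinct vs
    × (∀ {p} → p ∈ vs → IsVertex d p × Integral p)
    × (∀ p → IsVertex d p → Any (λ q → p ≈P q) vs)

-- Write m = d − 2, A_k = x_k − x_{k+1}, B_k = y_k − y_{k+1} (with x_{m+1} = y_{m+1} = 0) and C_j for the
-- j-th form of the third family, so that C_0 = 0 and the equation says C_{m+1} = 0. Then 𝔓_d is cut out by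
-- C_{m+1} = 0 and the 3m slacks A_{m−i}, B_{i+1}, C_{i+1} ≥ 0 (i < m), and each such triple satisfies
-- 2C_{i+1} − C_i − C_{i+2} = 2 − A_{m−i} − B_{i+1}, so its three slacks never vanish together.
-- For each of the 3^m words choosing one slack per triple there is exactly one feasible point at which all
-- unchosen slacks vanish: for two such points the difference δ of their C-sequences vanishes at both ends
-- and at each interior index either vanishes or is discretely harmonic, whence by summation by parts
-- Σ (δ_{i+1} − δ_i)² = Σ δ_{i+1} (2δ_{i+1} − δ_i − δ_{i+2}) = 0. On a run of chosen C's, C_j is the product
-- of the distances from j to the ends of the run, so the point is integral; it is a vertex because a
-- segment through it keeps those slacks zero. Conversely a vertex p is the point of the word choosing a
-- nonzero slack of p in each triple: the nonzero slacks of that point are among those of p, so otherwise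
-- p would be the midpoint of a short feasible segment. Finally C_1, C_m ≥ 0 bound all coordinates by 2m.

module Submission where

open import Defs
open import Data.Nat as ℕ using (ℕ; zero; suc; _∸_; _^_; z≤n; s≤s)
import Data.Nat.Properties as ℕP
import Data.Nat.Solver as ℕ-Solver
import Data.Nat.Coprimality as Coprime
open import Data.Integer as ℤ using (+_; -[1+_])
import Data.Integer.Properties as ℤP
open import Data.Rational as ℚ using (ℚ; 0ℚ; 1ℚ; ½; _+_; _*_; _-_; -_; _≤_; _<_; _⊓_; 1/_)
import Data.Rational.Properties as ℚP
import Data.Rational.Unnormalised as ℚᵘ
import Data.Rational.Unnormalised.Properties as ℚᵘP
open import Data.Rational.Solver using (module +-*-Solver)
open +-*-Solver
open import Data.Fin using (Fin; toℕ)
import Data.Fin.Properties as FinP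
open import Data.Vec using (Vec; []; _∷_)
import Data.Vec.Properties as VecP
open import Data.List using (List; []; _∷_; map; length; upTo; cartesianProduct; cartesianProductWith)
import Data.List.Properties as ListP
open import Data.List.Membership.Propositional using (_∈_)
open import Data.List.Membership.Propositional.Properties
  using (∈-map⁺; ∈-map⁻; ∈-upTo⁺; ∈-upTo⁻; ∈-cartesianProduct⁺; ∈-cartesianProduct⁻; ∈-cartesianProductWith⁺)
open import Data.List.Relation.Unary.Any as Any using (here; there)
import Data.List.Relation.Unary.All as All
open import Data.List.Relation.Unary.AllPairs using ([]; _∷_)
open import Data.List.Relation.Unary.Unique.Propositional using (Unique)
import Data.List.Relation.Unary.Unique.Propositional.Properties as Unique
open import Data.Product using (_×_; _,_; proj₁; proj₂; ∃)
open import Data.Sum using (_⊎_; inj₁; inj₂; [_,_]′)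
open import Data.Empty using (⊥-elim)
open import Function using (_∘_; case_of_)
open import Relation.Nullary using (Dec; yes; no; ¬_)
open import Relation.Nullary.Decidable using (toWitness)
open import Relation.Binary.Definitions using (DecidableEquality; tri<; tri≈; tri>)
open import Relation.Binary.PropositionalEquality

cong₃ : ∀ {a b c d} {A : Set a} {B : Set b} {C : Set c} {D : Set d} (f : A → B → C → D) {a a′ b b′ c c′} → a ≡ a′ → b ≡ b′ → c ≡ c′ → f a b c ≡ f a′ b′ c′
cong₃ f refl refl refl = refl

ιℤ-toℚᵘ : ∀ k → ℚ.toℚᵘ (ιℤ k) ≡ ℚᵘ.mkℚᵘ k 0
ιℤ-toℚᵘ (+ n)    rewrite ℚP.normalize-coprime (Coprime.sym (Coprime.1-coprimeTo n)) = refl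
ιℤ-toℚᵘ -[1+ n ] rewrite ℚP.normalize-coprime (Coprime.sym (Coprime.1-coprimeTo (suc n))) = refl

ιℤ-+ : ∀ a b → ιℤ (a ℤ.+ b) ≡ ιℤ a + ιℤ b
ιℤ-+ a b = ℚP.toℚᵘ-injective (begin
  ℚ.toℚᵘ (ιℤ (a ℤ.+ b))              ≈⟨ ℚᵘP.≃-reflexive (ιℤ-toℚᵘ (a ℤ.+ b)) ⟩
  ℚᵘ.mkℚᵘ (a ℤ.+ b) 0                ≈⟨ ℚᵘ.*≡* (cong (ℤ._* + 1) (cong₂ ℤ._+_ (sym (ℤP.*-identityʳ a)) (sym (ℤP.*-identityʳ b)))) ⟩
  ℚᵘ.mkℚᵘ a 0 ℚᵘ.+ ℚᵘ.mkℚᵘ b 0       ≈⟨ ℚᵘP.≃-sym (ℚᵘP.≃-reflexive (cong₂ ℚᵘ._+_ (ιℤ-toℚᵘ a) (ιℤ-toℚᵘ b))) ⟩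
  ℚ.toℚᵘ (ιℤ a) ℚᵘ.+ ℚ.toℚᵘ (ιℤ b)   ≈⟨ ℚᵘP.≃-sym (ℚP.toℚᵘ-homo-+ (ιℤ a) (ιℤ b)) ⟩
  ℚ.toℚᵘ (ιℤ a + ιℤ b)               ∎)
  where open ℚᵘP.≃-Reasoning

ιℤ-neg : ∀ a → ιℤ (ℤ.- a) ≡ - ιℤ a
ιℤ-neg a = ℚP.toℚᵘ-injective (begin
  ℚ.toℚᵘ (ιℤ (ℤ.- a))       ≈⟨ ℚᵘP.≃-reflexive (trans (ιℤ-toℚᵘ (ℤ.- a)) (cong ℚᵘ.-_ (sym (ιℤ-toℚᵘ a)))) ⟩
  ℚᵘ.- ℚ.toℚᵘ (ιℤ a)        ≈⟨ ℚᵘP.≃-sym (ℚP.toℚᵘ-homo‿- (ιℤ a)) ⟩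
  ℚ.toℚᵘ (- ιℤ a)           ∎)
  where open ℚᵘP.≃-Reasoning

ι-+ : ∀ a b → ι (a ℕ.+ b) ≡ ι a + ι b
ι-+ a b = ιℤ-+ (+ a) (+ b)

ι-injective : ∀ {a b} → ι a ≡ ι b → a ≡ b
ι-injective {a} {b} e =
  ℤP.+-injective (cong ℚᵘ.↥_ (trans (sym (ιℤ-toℚᵘ (+ a))) (trans (cong ℚ.toℚᵘ e) (ιℤ-toℚᵘ (+ b)))))

0≤ι : ∀ n → 0ℚ ≤ ι n
0≤ι n = ℚP.nonNegative⁻¹ _ {{ℚP.normalize-nonNeg n 1}}

ι-+-cancelʳ : ∀ a b → ι (a ℕ.+ b) - ι b ≡ ι a
ι-+-cancelʳ a b = trans (cong (_- ι b) (ι-+ a b)) (solve 2 (λ a b → (a :+ b) :- b := a) refl (ι a) (ι b))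

p≤q⇒0≤q-p : ∀ {p q} → p ≤ q → 0ℚ ≤ q - p
p≤q⇒0≤q-p {p} h = ℚP.≤-trans (ℚP.≤-reflexive (sym (ℚP.+-inverseʳ p))) (ℚP.+-monoˡ-≤ (- p) h)

p<q⇒0<q-p : ∀ {p q} → p < q → 0ℚ < q - p
p<q⇒0<q-p {p} h = ℚP.≤-<-trans (ℚP.≤-reflexive (sym (ℚP.+-inverseʳ p))) (ℚP.+-monoˡ-< (- p) h)

0≤q-p⇒p≤q : ∀ {p q} → 0ℚ ≤ q - p → p ≤ q
0≤q-p⇒p≤q {p} {q} h = begin
  p             ≡⟨ sym (ℚP.+-identityˡ p) ⟩
  0ℚ + p        ≤⟨ ℚP.+-monoˡ-≤ p h ⟩
  (q - p) + p   ≡⟨ solve 2 (λ p q → (q :- p) :+ p := q) refl p q ⟩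
  q             ∎
  where open ℚP.≤-Reasoning

q-p≡0⇒p≡q : ∀ {p q} → q - p ≡ 0ℚ → p ≡ q
q-p≡0⇒p≡q {p} {q} e = begin
  p                 ≡⟨ sym (ℚP.+-identityˡ p) ⟩
  0ℚ + p            ≡⟨ cong (_+ p) (sym e) ⟩
  (q - p) + p       ≡⟨ solve 2 (λ p q → (q :- p) :+ p := q) refl p q ⟩
  q                 ∎
  where open ≡-Reasoning

+-nonNeg : ∀ {p q} → 0ℚ ≤ p → 0ℚ ≤ q → 0ℚ ≤ p + q
+-nonNeg h h′ = ℚP.+-mono-≤ h h′

+-pos : ∀ {p q} → 0ℚ < p → 0ℚ < q → 0ℚ < p + q
+-pos h h′ = ℚP.+-mono-< h h′

*-nonNeg : ∀ {p q} → 0ℚ ≤ p → 0ℚ ≤ q → 0ℚ ≤ p * q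
*-nonNeg {p} {q} h h′ =
  ℚP.nonNegative⁻¹ _ {{ℚP.nonNeg*nonNeg⇒nonNeg p {{ℚ.nonNegative h}} q {{ℚ.nonNegative h′}}}}

*-pos : ∀ {p q} → 0ℚ < p → 0ℚ < q → 0ℚ < p * q
*-pos {p} {q} h h′ = ℚP.positive⁻¹ _ {{ℚP.pos*pos⇒pos p {{ℚ.positive h}} q {{ℚ.positive h′}}}}

square-nonNeg : ∀ p → 0ℚ ≤ p * p
square-nonNeg p with ℚP.≤-total 0ℚ p
... | inj₁ h = *-nonNeg h h
... | inj₂ h = ℚP.nonNegative⁻¹ _ {{ℚP.nonPos*nonPos⇒nonPos p {{ℚ.nonPositive h}} p {{ℚ.nonPositive h}}}}

square≡0⇒≡0 : ∀ p → p * p ≡ 0ℚ → p ≡ 0ℚ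
square≡0⇒≡0 p e with ℚP.<-cmp p 0ℚ
... | tri< p<0 _ _ = ⊥-elim (ℚP.<⇒≢ (ℚP.positive⁻¹ _ {{ℚP.neg*neg⇒pos p {{ℚ.negative p<0}} p {{ℚ.negative p<0}}}}) (sym e))
... | tri≈ _ p≡0 _ = p≡0
... | tri> _ _ p>0 = ⊥-elim (ℚP.<⇒≢ (*-pos p>0 p>0) (sym e))

nonNeg+nonNeg≡0⇒≡0 : ∀ {p q} → 0ℚ ≤ p → 0ℚ ≤ q → p + q ≡ 0ℚ → p ≡ 0ℚ
nonNeg+nonNeg≡0⇒≡0 {p} h h′ e = ℚP.≤-antisym (begin
  p        ≡⟨ sym (ℚP.+-identityʳ p) ⟩
  p + 0ℚ   ≤⟨ ℚP.+-monoʳ-≤ p h′ ⟩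
  _        ≡⟨ e ⟩
  0ℚ       ∎) h
  where open ℚP.≤-Reasoning

*-cancelˡ-≡-pos : ∀ {r p q} → 0ℚ < r → r * p ≡ r * q → p ≡ q
*-cancelˡ-≡-pos {r} r>0 e = ℚP.≤-antisym
  (ℚP.*-cancelˡ-≤-pos r {{ℚ.positive r>0}} (ℚP.≤-reflexive e))
  (ℚP.*-cancelˡ-≤-pos r {{ℚ.positive r>0}} (ℚP.≤-reflexive (sym e)))

sum-split : ∀ {a b a′ b′ : ℚ} → a + b ≡ a′ + b′ → (a ≡ 0ℚ × a′ ≡ 0ℚ) ⊎ (b ≡ 0ℚ × b′ ≡ 0ℚ) → a ≡ a′ × b ≡ b′
sum-split {a} {b} {a′} {b′} e (inj₁ (refl , refl)) =
  refl , trans (sym (ℚP.+-identityˡ b)) (trans e (ℚP.+-identityˡ b′))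
sum-split {a} {b} {a′} {b′} e (inj₂ (refl , refl)) =
  trans (sym (ℚP.+-identityʳ a)) (trans e (ℚP.+-identityʳ a′)) , refl

∣p∣≤q : ∀ {p q} → 0ℚ ≤ p + q → p ≤ q → ℚ.∣ p ∣ ≤ q
∣p∣≤q {p} {q} 0≤p+q p≤q with ℚP.∣p∣≡p∨∣p∣≡-p p
... | inj₁ ∣p∣≡p  = subst (_≤ q) (sym ∣p∣≡p) p≤q
... | inj₂ ∣p∣≡-p = subst (_≤ q) (sym ∣p∣≡-p)
                      (0≤q-p⇒p≤q (subst (0ℚ ≤_) (solve 2 (λ p q → p :+ q := q :- (:- p)) refl p q) 0≤p+q))

comb≡0⇒≡0 : ∀ {t p q} → 0ℚ < t → t < 1ℚ → 0ℚ ≤ p → 0ℚ ≤ q →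
            t * p + (1ℚ - t) * q ≡ 0ℚ → p ≡ 0ℚ × q ≡ 0ℚ
comb≡0⇒≡0 {t} {p} {q} t>0 t<1 p≥0 q≥0 e =
  *-cancelˡ-≡-pos t>0 (trans (nonNeg+nonNeg≡0⇒≡0 tp≥0 sq≥0 e) (sym (ℚP.*-zeroʳ t))) ,
  *-cancelˡ-≡-pos 1-t>0 (trans (nonNeg+nonNeg≡0⇒≡0 sq≥0 tp≥0 (trans (ℚP.+-comm ((1ℚ - t) * q) (t * p)) e)) (sym (ℚP.*-zeroʳ (1ℚ - t))))
  where
  1-t>0 = p<q⇒0<q-p t<1
  tp≥0 = *-nonNeg (ℚP.<⇒≤ t>0) p≥0
  sq≥0 = *-nonNeg (ℚP.<⇒≤ 1-t>0) q≥0

extrapolation-midpoint : ∀ s a b → a ≡ ½ * (s * b + (1ℚ - s) * a) + (1ℚ - ½) * ((1ℚ + s) * a + (1ℚ - (1ℚ + s)) * b)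
extrapolation-midpoint = solve 3 (λ s a b → a := con ½ :* (s :* b :+ (con 1ℚ :- s) :* a)
                                     :+ (con 1ℚ :- con ½) :* ((con 1ℚ :+ s) :* a :+ (con 1ℚ :- (con 1ℚ :+ s)) :* b)) refl

extrapolation-cancel : ∀ {s a b} → 0ℚ < s → s * b + (1ℚ - s) * a ≡ (1ℚ + s) * a + (1ℚ - (1ℚ + s)) * b → a ≡ b
extrapolation-cancel {s} {a} {b} s>0 e = *-cancelˡ-≡-pos (+-pos s>0 s>0) (begin
  (s + s) * a             ≡⟨ solve 3 (λ s a b → (s :+ s) :* a
                                               := (((con 1ℚ :+ s) :* a :+ (con 1ℚ :- (con 1ℚ :+ s)) :* b)
                                                   :- (s :* b :+ (con 1ℚ :- s) :* a)) :+ (s :+ s) :* b) refl s a b ⟩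
  (R′ - L′) + (s + s) * b ≡⟨ cong (λ c → (c - L′) + (s + s) * b) (sym e) ⟩
  (L′ - L′) + (s + s) * b ≡⟨ solve 2 (λ l c → (l :- l) :+ c := c) refl L′ ((s + s) * b) ⟩
  (s + s) * b             ∎)
  where
  open ≡-Reasoning
  L′ = s * b + (1ℚ - s) * a
  R′ = (1ℚ + s) * a + (1ℚ - (1ℚ + s)) * b

scale-below : ∀ {u w} → 0ℚ ≤ u → 0ℚ ≤ w → (u ≡ 0ℚ → w ≡ 0ℚ) → ∃ λ s → 0ℚ < s × s * w ≤ u
scale-below {u} {w} u≥0 w≥0 u≡0⇒w≡0 with ℚP.<-cmp 0ℚ u
... | tri> _ _ u<0 = ⊥-elim (ℚP.<-irrefl refl (ℚP.<-≤-trans u<0 u≥0))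
... | tri≈ _ 0≡u _ = 1ℚ , ℚP.positive⁻¹ 1ℚ , ℚP.≤-reflexive (begin
  1ℚ * w   ≡⟨ cong (1ℚ *_) (u≡0⇒w≡0 (sym 0≡u)) ⟩
  1ℚ * 0ℚ  ≡⟨ 0≡u ⟩
  u        ∎)
  where open ≡-Reasoning
... | tri< u>0 _ _ = s , s>0 , (begin
  s * w                        ≤⟨ ℚP.*-monoˡ-≤-nonNeg s {{ℚ.nonNegative (ℚP.<⇒≤ s>0)}} w≤u+w ⟩
  s * (u + w)                  ≡⟨ ℚP.*-assoc u (1/ (u + w)) (u + w) ⟩
  u * (1/ (u + w) * (u + w))   ≡⟨ cong (u *_) (ℚP.*-inverseˡ (u + w)) ⟩
  u * 1ℚ                       ≡⟨ ℚP.*-identityʳ u ⟩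
  u                            ∎)
  where
  open ℚP.≤-Reasoning
  u+w>0 : 0ℚ < u + w
  u+w>0 = ℚP.<-≤-trans u>0 (begin u ≡⟨ sym (ℚP.+-identityʳ u) ⟩ u + 0ℚ ≤⟨ ℚP.+-monoʳ-≤ u w≥0 ⟩ u + w ∎)
  instance
    u+w≢0 : ℚ.NonZero (u + w)
    u+w≢0 = ℚP.pos⇒nonZero (u + w) {{ℚ.positive u+w>0}}
  s : ℚ
  s = u * 1/ (u + w)
  s>0 : 0ℚ < s
  s>0 = *-pos u>0 (ℚP.positive⁻¹ _ {{ℚP.1/pos⇒pos (u + w) {{ℚ.positive u+w>0}}}})
  w≤u+w : w ≤ u + w
  w≤u+w = begin w ≡⟨ sym (ℚP.+-identityˡ w) ⟩ 0ℚ + w ≤⟨ ℚP.+-monoˡ-≤ w u≥0 ⟩ u + w ∎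

uniform-scale-below : ∀ {I : Set} (ks : List I) (u w : I → ℚ) →
  (∀ {k} → k ∈ ks → 0ℚ ≤ u k × 0ℚ ≤ w k × (u k ≡ 0ℚ → w k ≡ 0ℚ)) →
  ∃ λ s → 0ℚ < s × s ≤ 1ℚ × (∀ {k} → k ∈ ks → s * w k ≤ u k)
uniform-scale-below []       u w _   = 1ℚ , ℚP.positive⁻¹ 1ℚ , ℚP.≤-refl , λ ()
uniform-scale-below (k ∷ ks) u w hyp with hyp (here refl) | uniform-scale-below ks u w (hyp ∘ there)
... | u≥0 , w≥0 , u≡0⇒w≡0 | s , s>0 , s≤1 , below with scale-below u≥0 w≥0 u≡0⇒w≡0
...   | sₖ , sₖ>0 , sₖw≤u = s ⊓ sₖ , min>0 , ℚP.≤-trans (ℚP.p⊓q≤p s sₖ) s≤1 , λ where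
    (here refl) → ℚP.≤-trans (≤-scale (ℚP.p⊓q≤q s sₖ) w≥0) sₖw≤u
    (there k∈)  → ℚP.≤-trans (≤-scale (ℚP.p⊓q≤p s sₖ) (proj₁ (proj₂ (hyp (there k∈))))) (below k∈)
  where
  min>0 : 0ℚ < s ⊓ sₖ
  min>0 = [ (λ e → subst (0ℚ <_) (sym e) s>0) , (λ e → subst (0ℚ <_) (sym e) sₖ>0) ]′ (ℚP.⊓-sel s sₖ)
  ≤-scale : ∀ {a b c} → a ≤ b → 0ℚ ≤ c → a * c ≤ b * c
  ≤-scale a≤b c≥0 = ℚP.*-monoʳ-≤-nonNeg _ {{ℚ.nonNegative c≥0}} a≤b

-- Finite sums and sequences

sumTo-cong : ∀ n {f g : ℕ → ℚ} → (∀ i → i ℕ.< n → f i ≡ g i) → sumTo n f ≡ sumTo n g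
sumTo-cong zero    e = refl
sumTo-cong (suc n) e = cong₂ _+_ (sumTo-cong n (λ i i<n → e i (ℕP.m<n⇒m<1+n i<n))) (e n ℕP.≤-refl)

sumTo-comb : ∀ n t (f g : ℕ → ℚ) →
             sumTo n (λ i → t * f i + (1ℚ - t) * g i) ≡ t * sumTo n f + (1ℚ - t) * sumTo n g
sumTo-comb zero    t f g = solve 1 (λ t → con 0ℚ := t :* con 0ℚ :+ (con 1ℚ :- t) :* con 0ℚ) refl t
sumTo-comb (suc n) t f g = trans (cong (_+ (t * f n + (1ℚ - t) * g n)) (sumTo-comb n t f g))
  (solve 5 (λ t a b c e → (t :* a :+ (con 1ℚ :- t) :* b) :+ (t :* c :+ (con 1ℚ :- t) :* e)
                           := t :* (a :+ c) :+ (con 1ℚ :- t) :* (b :+ e))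
           refl t (sumTo n f) (sumTo n g) (f n) (g n))

sumTo-shift : ∀ n (f : ℕ → ℚ) → sumTo (suc n) f ≡ f 0 + sumTo n (f ∘ suc)
sumTo-shift zero    f = trans (ℚP.+-identityˡ (f 0)) (sym (ℚP.+-identityʳ (f 0)))
sumTo-shift (suc n) f = trans (cong (_+ f (suc n)) (sumTo-shift n f)) (ℚP.+-assoc (f 0) _ (f (suc n)))

sumTo-reverse : ∀ n (f : ℕ → ℚ) → sumTo n (λ i → f (n ∸ i)) ≡ sumTo n (f ∘ suc)
sumTo-reverse zero    f = refl
sumTo-reverse (suc n) f = begin
  sumTo n (λ i → f (suc n ∸ i)) + f (suc n ∸ n)
    ≡⟨ cong₂ _+_ (sumTo-cong n (λ i i<n → cong f (ℕP.+-∸-assoc 1 (ℕP.<⇒≤ i<n))))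
                 (cong f (ℕP.+-∸-assoc 1 (ℕP.≤-refl {n}))) ⟩
  sumTo n (λ i → f (suc (n ∸ i))) + f (suc (n ∸ n))
    ≡⟨ cong₂ _+_ (sumTo-reverse n (f ∘ suc)) (cong (f ∘ suc) (ℕP.n∸n≡0 n)) ⟩
  sumTo n (f ∘ suc ∘ suc) + f 1
    ≡⟨ ℚP.+-comm _ (f 1) ⟩
  f 1 + sumTo n (f ∘ suc ∘ suc)
    ≡⟨ sym (sumTo-shift n (f ∘ suc)) ⟩
  sumTo (suc n) (f ∘ suc) ∎
  where open ≡-Reasoning

sumTo-nonNeg : ∀ n {f : ℕ → ℚ} → (∀ i → 0ℚ ≤ f i) → 0ℚ ≤ sumTo n f
sumTo-nonNeg zero    f≥0 = ℚP.≤-refl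
sumTo-nonNeg (suc n) f≥0 = +-nonNeg (sumTo-nonNeg n f≥0) (f≥0 n)

sumTo-zero : ∀ n {f : ℕ → ℚ} → (∀ i → i ℕ.< n → f i ≡ 0ℚ) → sumTo n f ≡ 0ℚ
sumTo-zero zero    f≡0 = refl
sumTo-zero (suc n) f≡0 = cong₂ _+_ (sumTo-zero n (λ i i<n → f≡0 i (ℕP.m<n⇒m<1+n i<n))) (f≡0 n ℕP.≤-refl)

nonNeg-sumTo≡0⇒≡0 : ∀ n {f : ℕ → ℚ} → (∀ i → 0ℚ ≤ f i) → sumTo n f ≡ 0ℚ → ∀ i → i ℕ.< n → f i ≡ 0ℚ
nonNeg-sumTo≡0⇒≡0 (suc n) {f} f≥0 e i i<1+n with ℕP.m≤n⇒m<n∨m≡n (ℕP.≤-pred i<1+n)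
... | inj₁ i<n  = nonNeg-sumTo≡0⇒≡0 n f≥0 (nonNeg+nonNeg≡0⇒≡0 (sumTo-nonNeg n f≥0) (f≥0 n) e) i i<n
... | inj₂ refl = nonNeg+nonNeg≡0⇒≡0 (f≥0 n) (sumTo-nonNeg n f≥0) (trans (ℚP.+-comm (f n) (sumTo n f)) e)

downward-induction : ∀ {ℓ} (P : ℕ → Set ℓ) {n} → P n → (∀ k → k ℕ.< n → P (suc k) → P k) →
                     ∀ k → k ℕ.≤ n → P k
downward-induction P {n} Pn step k k≤n = go (n ∸ k) k (ℕP.m∸n+n≡m k≤n)
  where
  go : ∀ d k → d ℕ.+ k ≡ n → P k
  go zero    k refl = Pn
  go (suc d) k e    = step k (subst (k ℕ.<_) e (s≤s (ℕP.m≤n+m k d)))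
                             (go d (suc k) (trans (ℕP.+-suc d k) e))

∀<-suc⇒∀<-∸ : ∀ {ℓ} (P : ℕ → Set ℓ) n → (∀ k → k ℕ.< n → P (suc k)) → ∀ i → i ℕ.< n → P (n ∸ i)
∀<-suc⇒∀<-∸ P n h i i<n = subst P (sym n∸i≡suc) (h (n ∸ suc i) (subst (ℕ._≤ n) n∸i≡suc (ℕP.m∸n≤m n i)))
  where
  n∸i≡suc : n ∸ i ≡ suc (n ∸ suc i)
  n∸i≡suc = ℕP.+-∸-assoc 1 i<n

∀<-∸⇒∀<-suc : ∀ {ℓ} (P : ℕ → Set ℓ) n → (∀ i → i ℕ.< n → P (n ∸ i)) → ∀ k → k ℕ.< n → P (suc k)
∀<-∸⇒∀<-suc P n h k k<n = subst P (ℕP.m∸[m∸n]≡n k<n) (h (n ∸ suc k) (ℕP.∸-monoʳ-< {n} (s≤s z≤n) k<n))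

decrement : (ℕ → ℚ) → ℕ → ℚ
decrement f k = f k - f (suc k)

nonNeg-from-decrements : ∀ {n} (f : ℕ → ℚ) → f n ≡ 0ℚ → (∀ k → k ℕ.< n → 0ℚ ≤ decrement f k) →
                         ∀ k → k ℕ.≤ n → 0ℚ ≤ f k
nonNeg-from-decrements f fn≡0 dec≥0 = downward-induction (λ k → 0ℚ ≤ f k)
  (ℚP.≤-reflexive (sym fn≡0))
  (λ k k<n fk+1≥0 → ℚP.≤-trans fk+1≥0 (0≤q-p⇒p≤q (dec≥0 k k<n)))

≡-from-decrements : ∀ {n} (f g : ℕ → ℚ) → f n ≡ g n → (∀ k → k ℕ.< n → decrement f k ≡ decrement g k) →
                    ∀ k → k ℕ.≤ n → f k ≡ g k
≡-from-decrements f g top dec≡ = downward-induction (λ k → f k ≡ g k) top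
  (λ k k<n e → begin
     f k                                ≡⟨ solve 2 (λ a b → a := (a :- b) :+ b) refl (f k) (f (suc k)) ⟩
     decrement f k + f (suc k)          ≡⟨ cong₂ _+_ (dec≡ k k<n) e ⟩
     decrement g k + g (suc k)          ≡⟨ solve 2 (λ a b → (a :- b) :+ b := a) refl (g k) (g (suc k)) ⟩
     g k                                ∎)
  where open ≡-Reasoning

decrements-nonNeg⇒≤-head : ∀ {n} (f : ℕ → ℚ) → (∀ k → k ℕ.< n → 0ℚ ≤ decrement f k) → ∀ k → k ℕ.≤ n → f k ≤ f 0
decrements-nonNeg⇒≤-head f dec≥0 zero    _         = ℚP.≤-refl
decrements-nonNeg⇒≤-head f dec≥0 (suc k) 1+k≤n = ℚP.≤-trans (0≤q-p⇒p≤q (dec≥0 k 1+k≤n))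
                                                   (decrements-nonNeg⇒≤-head f dec≥0 k (ℕP.<⇒≤ 1+k≤n))

AntitoneNonNeg : ℕ → (ℕ → ℚ) → Set
AntitoneNonNeg n f = (∀ j → 1 ℕ.≤ j → j ℕ.≤ n ∸ 1 → f (suc j) ≤ f j) × (∀ j → 1 ℕ.≤ j → j ℕ.≤ n → 0ℚ ≤ f j)

antitoneNonNeg⇒decrements : ∀ n (f : ℕ → ℚ) → f (suc n) ≡ 0ℚ → AntitoneNonNeg n f →
                            ∀ k → k ℕ.< n → 0ℚ ≤ decrement f (suc k)
antitoneNonNeg⇒decrements (suc n) f top (antitone , nonNeg) k k<1+n with ℕP.m≤n⇒m<n∨m≡n k<1+n
... | inj₁ (s≤s 1+k≤n) = p≤q⇒0≤q-p (antitone (suc k) (s≤s z≤n) 1+k≤n)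
... | inj₂ refl        = subst (λ a → 0ℚ ≤ f (suc k) - a) (sym top)
                               (subst (0ℚ ≤_) (sym (ℚP.+-identityʳ (f (suc k)))) (nonNeg (suc k) (s≤s z≤n) ℕP.≤-refl))

decrements⇒antitoneNonNeg : ∀ n (f : ℕ → ℚ) → f (suc n) ≡ 0ℚ →
                            (∀ k → k ℕ.< n → 0ℚ ≤ decrement f (suc k)) → AntitoneNonNeg n f
decrements⇒antitoneNonNeg n f top dec≥0 = antitone , nonNeg
  where
  antitone : ∀ j → 1 ℕ.≤ j → j ℕ.≤ n ∸ 1 → f (suc j) ≤ f j
  antitone (suc k) _ 1+k≤n∸1 = 0≤q-p⇒p≤q (dec≥0 k (ℕP.<-trans (ℕP.n<1+n k) (≤∸1⇒< n 1+k≤n∸1)))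
    where
    ≤∸1⇒< : ∀ n {j} → suc j ℕ.≤ n ∸ 1 → suc j ℕ.< n
    ≤∸1⇒< (suc n) j<n = s≤s j<n
  nonNeg : ∀ j → 1 ℕ.≤ j → j ℕ.≤ n → 0ℚ ≤ f j
  nonNeg (suc k) _ 1+k≤n = nonNeg-from-decrements (f ∘ suc) top dec≥0 k (ℕP.<⇒≤ 1+k≤n)

secondDiff : (ℕ → ℚ) → ℕ → ℚ
secondDiff f i = (f (suc i) + f (suc i)) - f i - f (suc (suc i))

secondDiff-sub : ∀ (f g : ℕ → ℚ) i → secondDiff (λ j → f j - g j) i ≡ secondDiff f i - secondDiff g i
secondDiff-sub f g i = solve 6 (λ a₀ a₁ a₂ b₀ b₁ b₂ → ((a₁ :- b₁) :+ (a₁ :- b₁)) :- (a₀ :- b₀) :- (a₂ :- b₂)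
                                                  := ((a₁ :+ a₁) :- a₀ :- a₂) :- ((b₁ :+ b₁) :- b₀ :- b₂))
                           refl (f i) (f (suc i)) (f (suc (suc i))) (g i) (g (suc i)) (g (suc (suc i)))

secondDiff-unique : ∀ {n} (f g : ℕ → ℚ) → f 0 ≡ g 0 → f 1 ≡ g 1 →
                    (∀ i → i ℕ.< n → secondDiff f i ≡ secondDiff g i) → ∀ j → j ℕ.≤ suc n → f j ≡ g j
secondDiff-unique {n} f g e₀ e₁ Δ²≡ zero    _         = e₀
secondDiff-unique {n} f g e₀ e₁ Δ²≡ (suc i) (s≤s i≤n) = proj₂ (consecutive i i≤n)
  where
  next : ∀ (h : ℕ → ℚ) i → h (suc (suc i)) ≡ (h (suc i) + h (suc i)) - h i - secondDiff h i
  next h i = solve 3 (λ a b c → c := (b :+ b) :- a :- ((b :+ b) :- a :- c)) refl (h i) (h (suc i)) (h (suc (suc i)))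
  consecutive : ∀ i → i ℕ.≤ n → f i ≡ g i × f (suc i) ≡ g (suc i)
  consecutive zero    _   = e₀ , e₁
  consecutive (suc i) i<n with consecutive i (ℕP.<⇒≤ i<n)
  ... | eᵢ , eᵢ₊₁ = eᵢ₊₁ , (begin
    f (suc (suc i))                                   ≡⟨ next f i ⟩
    (f (suc i) + f (suc i)) - f i - secondDiff f i    ≡⟨ cong₂ (λ a b → (a + a) - b - secondDiff f i) eᵢ₊₁ eᵢ ⟩
    (g (suc i) + g (suc i)) - g i - secondDiff f i    ≡⟨ cong (_-_ ((g (suc i) + g (suc i)) - g i)) (Δ²≡ i i<n) ⟩
    (g (suc i) + g (suc i)) - g i - secondDiff g i    ≡⟨ sym (next g i) ⟩
    g (suc (suc i))                                   ∎)
    where open ≡-Reasoning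

summation-by-parts : ∀ (δ : ℕ → ℚ) → δ 0 ≡ 0ℚ → ∀ n →
  sumTo n (λ i → δ (suc i) * secondDiff δ i)
    ≡ sumTo n (λ i → (δ (suc i) - δ i) * (δ (suc i) - δ i)) + δ n * decrement δ n
summation-by-parts δ δ₀ zero = begin
  0ℚ                          ≡⟨ solve 1 (λ b → con 0ℚ := con 0ℚ :+ con 0ℚ :* (con 0ℚ :- b)) refl (δ 1) ⟩
  0ℚ + 0ℚ * (0ℚ - δ 1)        ≡⟨ cong (λ a → 0ℚ + a * (a - δ 1)) (sym δ₀) ⟩
  0ℚ + δ 0 * decrement δ 0    ∎
  where open ≡-Reasoning
summation-by-parts δ δ₀ (suc n) = begin
  sumTo n (λ i → δ (suc i) * secondDiff δ i) + δ (suc n) * secondDiff δ n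
    ≡⟨ cong (_+ δ (suc n) * secondDiff δ n) (summation-by-parts δ δ₀ n) ⟩
  (S + δ n * decrement δ n) + δ (suc n) * secondDiff δ n
    ≡⟨ solve 4 (λ s a b c → (s :+ a :* (a :- b)) :+ b :* (((b :+ b) :- a) :- c)
                            := (s :+ (b :- a) :* (b :- a)) :+ b :* (b :- c))
             refl S (δ n) (δ (suc n)) (δ (suc (suc n))) ⟩
  (S + (δ (suc n) - δ n) * (δ (suc n) - δ n)) + δ (suc n) * decrement δ (suc n) ∎
  where
  open ≡-Reasoning
  S = sumTo n (λ i → (δ (suc i) - δ i) * (δ (suc i) - δ i))

zero-or-harmonic⇒zero : ∀ n (δ : ℕ → ℚ) → δ 0 ≡ 0ℚ → δ (suc n) ≡ 0ℚ →
  (∀ i → i ℕ.< n → δ (suc i) ≡ 0ℚ ⊎ secondDiff δ i ≡ 0ℚ) → ∀ j → j ℕ.≤ suc n → δ j ≡ 0ℚ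
zero-or-harmonic⇒zero n δ δ₀ δₙ₊₁ zero-or-harmonic = constant
  where
  jump² : ℕ → ℚ
  jump² i = (δ (suc i) - δ i) * (δ (suc i) - δ i)
  energy≡0 : sumTo (suc n) jump² ≡ 0ℚ
  energy≡0 = begin
    sumTo n jump² + (δ (suc n) - δ n) * (δ (suc n) - δ n)
      ≡⟨ cong (λ a → sumTo n jump² + (a - δ n) * (a - δ n)) δₙ₊₁ ⟩
    sumTo n jump² + (0ℚ - δ n) * (0ℚ - δ n)
      ≡⟨ solve 2 (λ s a → s :+ (con 0ℚ :- a) :* (con 0ℚ :- a) := s :+ a :* (a :- con 0ℚ)) refl (sumTo n jump²) (δ n) ⟩
    sumTo n jump² + δ n * (δ n - 0ℚ)
      ≡⟨ cong (λ a → sumTo n jump² + δ n * (δ n - a)) (sym δₙ₊₁) ⟩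
    sumTo n jump² + δ n * decrement δ n
      ≡⟨ sym (summation-by-parts δ δ₀ n) ⟩
    sumTo n (λ i → δ (suc i) * secondDiff δ i)
      ≡⟨ sumTo-zero n (λ i i<n → [ (λ e → trans (cong (_* secondDiff δ i) e) (ℚP.*-zeroˡ (secondDiff δ i)))
                                 , (λ e → trans (cong (δ (suc i) *_) e) (ℚP.*-zeroʳ (δ (suc i)))) ]′ (zero-or-harmonic i i<n)) ⟩
    0ℚ ∎
    where open ≡-Reasoning
  constant : ∀ j → j ℕ.≤ suc n → δ j ≡ 0ℚ
  constant zero    _         = δ₀
  constant (suc i) (s≤s i≤n) = trans
    (sym (q-p≡0⇒p≡q (square≡0⇒≡0 _ (nonNeg-sumTo≡0⇒≡0 (suc n) (λ k → square-nonNeg (δ (suc k) - δ k)) energy≡0 i (s≤s i≤n)))))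
    (constant i (ℕP.m≤n⇒m≤1+n i≤n))

at-beyond : ∀ {n} (v : Fin n → ℚ) {k} → n ℕ.≤ k → at v (suc k) ≡ 0ℚ
at-beyond {n} v {k} n≤k with k ℕ.<? n
... | yes k<n = ⊥-elim (ℕP.<-irrefl refl (ℕP.<-≤-trans k<n n≤k))
... | no _    = refl

at-toℕ : ∀ {n} (v : Fin n → ℚ) i → at v (suc (toℕ i)) ≡ v i
at-toℕ {n} v i with toℕ i ℕ.<? n
... | yes i<n = cong v (FinP.fromℕ<-toℕ i i<n)
... | no i≮n  = ⊥-elim (i≮n (FinP.toℕ<n i))

at-cong : ∀ {n} {u v : Fin n → ℚ} → (∀ i → u i ≡ v i) → ∀ j → at u j ≡ at v j
at-cong     e zero    = refl
at-cong {n} e (suc k) with k ℕ.<? n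
... | yes _ = e _
... | no _  = refl

at-comb : ∀ {n} t (u v : Fin n → ℚ) j → at (λ i → t * u i + (1ℚ - t) * v i) j ≡ t * at u j + (1ℚ - t) * at v j
at-comb     t u v zero    = solve 1 (λ t → con 0ℚ := t :* con 0ℚ :+ (con 1ℚ :- t) :* con 0ℚ) refl t
at-comb {n} t u v (suc k) with k ℕ.<? n
... | yes _ = refl
... | no _  = solve 1 (λ t → con 0ℚ := t :* con 0ℚ :+ (con 1ℚ :- t) :* con 0ℚ) refl t

at-tabulate : ∀ {n} (g : ℕ → ℚ) {k} → k ℕ.< n → at {n} (λ i → g (suc (toℕ i))) (suc k) ≡ g (suc k)
at-tabulate {n} g {k} k<n with k ℕ.<? n
... | yes k<n′ = cong (g ∘ suc) (FinP.toℕ-fromℕ< k<n′)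
... | no k≮n   = ⊥-elim (k≮n k<n)

sumFrom : ℕ → (ℕ → ℕ) → ℕ → ℕ
sumFrom zero    g k = 0
sumFrom (suc n) g k = g k ℕ.+ sumFrom n g (suc k)

tailSum : ℕ → (ℕ → ℕ) → ℕ → ℕ
tailSum m g k = sumFrom (suc m ∸ k) g k

tailSum-step : ∀ m g {k} → k ℕ.≤ m → tailSum m g k ≡ g k ℕ.+ tailSum m g (suc k)
tailSum-step m g {k} k≤m = cong (λ n → sumFrom n g k) (ℕP.+-∸-assoc 1 k≤m)

tailSum-top : ∀ m g → tailSum m g (suc m) ≡ 0
tailSum-top m g = cong (λ n → sumFrom n g (suc m)) (ℕP.n∸n≡0 m)

at-tailSum : ∀ m g {k} → k ℕ.≤ m → at {m} (λ i → ι (tailSum m g (suc (toℕ i)))) (suc k) ≡ ι (tailSum m g (suc k))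
at-tailSum m g {k} k≤m with ℕP.m≤n⇒m<n∨m≡n k≤m
... | inj₁ k<m  = at-tabulate {m} (ι ∘ tailSum m g) k<m
... | inj₂ refl = trans (at-beyond _ {k} ℕP.≤-refl) (cong ι (sym (tailSum-top k g)))

decrement-tailSum : ∀ m g {k} → k ℕ.< m → decrement (at {m} (λ i → ι (tailSum m g (suc (toℕ i))))) (suc k) ≡ ι (g (suc k))
decrement-tailSum m g {k} k<m = begin
  at v (suc k) - at v (suc (suc k))                                  ≡⟨ cong₂ _-_ (at-tailSum m g (ℕP.<⇒≤ k<m)) (at-tailSum m g k<m) ⟩
  ι (tailSum m g (suc k)) - ι (tailSum m g (suc (suc k)))            ≡⟨ cong (λ n → ι n - ι (tailSum m g (suc (suc k)))) (tailSum-step m g k<m) ⟩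
  ι (g (suc k) ℕ.+ tailSum m g (suc (suc k))) - ι (tailSum m g (suc (suc k))) ≡⟨ ι-+-cancelʳ (g (suc k)) _ ⟩
  ι (g (suc k))                                                      ∎
  where
  open ≡-Reasoning
  v : Fin m → ℚ
  v i = ι (tailSum m g (suc (toℕ i)))

-- The polytope in slack coordinates

data Family : Set where
  A B C : Family

_≟ᶠ_ : DecidableEquality Family
A ≟ᶠ A = yes refl
A ≟ᶠ B = no λ ()
A ≟ᶠ C = no λ ()
B ≟ᶠ A = no λ ()
B ≟ᶠ B = yes refl
B ≟ᶠ C = no λ ()
C ≟ᶠ A = no λ ()
C ≟ᶠ B = no λ ()
C ≟ᶠ C = yes refl

families : List Family
families = A ∷ B ∷ C ∷ []

∈-families : ∀ f → f ∈ families
∈-families A = here refl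
∈-families B = there (here refl)
∈-families C = there (there (here refl))

nonzeroFamily : (Family → ℚ) → Family
nonzeroFamily s with s C ℚP.≟ 0ℚ | s B ℚP.≟ 0ℚ
... | no _  | _     = C
... | yes _ | no _  = B
... | yes _ | yes _ = A

nonzeroFamily-≢0 : ∀ (s : Family → ℚ) → (s C ≡ 0ℚ → s B ≡ 0ℚ → s A ≢ 0ℚ) → s (nonzeroFamily s) ≢ 0ℚ
nonzeroFamily-≢0 s not-all-zero with s C ℚP.≟ 0ℚ | s B ℚP.≟ 0ℚ
... | no sC≢0  | _        = sC≢0
... | yes _    | no sB≢0  = sB≢0
... | yes sC≡0 | yes sB≡0 = not-all-zero sC≡0 sB≡0

module Polytope (m : ℕ) where

  X Y : Point m → ℕ → ℚ
  X (x , _ , _) = at x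
  Y (_ , y , _) = at y

  Z : Point m → ℚ
  Z (_ , _ , z) = z

  -- cForm p j is C_j, also for j = 0 and j = m + 1. The slack triple i < m is A at x-index m − i,
  -- B at y-index i + 1 and C at index i + 1.
  cForm : Point m → ℕ → ℚ
  cForm p j = (ι j * (Z p + ι (suc m ∸ j)) + sumTo (j ∸ 1) (λ i → X p (m ∸ i))) - sumTo j (λ i → Y p (suc i))

  slack : Family → Point m → ℕ → ℚ
  slack A p i = decrement (X p) (m ∸ i)
  slack B p i = decrement (Y p) (suc i)
  slack C p i = cForm p (suc i)

  record Affine (F : Point m → ℚ) : Set where
    field
      resp-≈P   : ∀ {p q} → p ≈P q → F p ≡ F q
      comb-homo : ∀ t p q → F (comb t p q) ≡ t * F p + (1ℚ - t) * F q
  open Affine public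

  private
    affine₂ : ∀ {F G} (_∙_ : ℚ → ℚ → ℚ) →
              (∀ t a b c d → (t * a + (1ℚ - t) * b) ∙ (t * c + (1ℚ - t) * d) ≡ t * (a ∙ c) + (1ℚ - t) * (b ∙ d)) →
              Affine F → Affine G → Affine (λ p → F p ∙ G p)
    affine₂ _∙_ distrib F G = record
      { resp-≈P   = λ e → cong₂ _∙_ (resp-≈P F e) (resp-≈P G e)
      ; comb-homo = λ t p q → trans (cong₂ _∙_ (comb-homo F t p q) (comb-homo G t p q)) (distrib t _ _ _ _)
      }

  affine-const : ∀ c → Affine (λ _ → c)
  affine-const c = record
    { resp-≈P   = λ _ → refl
    ; comb-homo = λ t _ _ → solve 2 (λ t c → c := t :* c :+ (con 1ℚ :- t) :* c) refl t c
    }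

  affine-+ : ∀ {F G} → Affine F → Affine G → Affine (λ p → F p + G p)
  affine-+ = affine₂ _+_
    (solve 5 (λ t a b c d → (t :* a :+ (con 1ℚ :- t) :* b) :+ (t :* c :+ (con 1ℚ :- t) :* d)
                            := t :* (a :+ c) :+ (con 1ℚ :- t) :* (b :+ d)) refl)

  affine-- : ∀ {F G} → Affine F → Affine G → Affine (λ p → F p - G p)
  affine-- = affine₂ _-_
    (solve 5 (λ t a b c d → (t :* a :+ (con 1ℚ :- t) :* b) :- (t :* c :+ (con 1ℚ :- t) :* d)
                            := t :* (a :- c) :+ (con 1ℚ :- t) :* (b :- d)) refl)

  affine-scale : ∀ c {F} → Affine F → Affine (λ p → c * F p)
  affine-scale c {F} F-affine = record
    { resp-≈P   = λ e → cong (c *_) (resp-≈P F-affine e)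
    ; comb-homo = λ t p q → trans (cong (c *_) (comb-homo F-affine t p q))
        (solve 4 (λ c t a b → c :* (t :* a :+ (con 1ℚ :- t) :* b) := t :* (c :* a) :+ (con 1ℚ :- t) :* (c :* b))
               refl c t (F p) (F q))
    }

  affine-sumTo : ∀ n {F : ℕ → Point m → ℚ} → (∀ i → Affine (F i)) → Affine (λ p → sumTo n (λ i → F i p))
  affine-sumTo n {F} F-affine = record
    { resp-≈P   = λ e → sumTo-cong n (λ i _ → resp-≈P (F-affine i) e)
    ; comb-homo = λ t p q → trans (sumTo-cong n (λ i _ → comb-homo (F-affine i) t p q))
                                  (sumTo-comb n t (λ i → F i p) (λ i → F i q))
    }

  affine-X : ∀ j → Affine (λ p → X p j)
  affine-X j = record { resp-≈P = λ (e , _ , _) → at-cong e j ; comb-homo = λ t p q → at-comb t _ _ j }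

  affine-Y : ∀ j → Affine (λ p → Y p j)
  affine-Y j = record { resp-≈P = λ (_ , e , _) → at-cong e j ; comb-homo = λ t p q → at-comb t _ _ j }

  affine-Z : Affine Z
  affine-Z = record { resp-≈P = λ (_ , _ , e) → e ; comb-homo = λ _ _ _ → refl }

  affine-cForm : ∀ j → Affine (λ p → cForm p j)
  affine-cForm j = affine-- (affine-+ (affine-scale (ι j) (affine-+ affine-Z (affine-const (ι (suc m ∸ j)))))
                                      (affine-sumTo (j ∸ 1) (λ i → affine-X (m ∸ i))))
                            (affine-sumTo j (λ i → affine-Y (suc i)))

  affine-slack : ∀ f i → Affine (λ p → slack f p i)
  affine-slack A i = affine-- (affine-X (m ∸ i)) (affine-X (suc (m ∸ i)))
  affine-slack B i = affine-- (affine-Y (suc i)) (affine-Y (suc (suc i)))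
  affine-slack C i = affine-cForm (suc i)

  X-top : ∀ p → X p (suc m) ≡ 0ℚ
  X-top (x , _ , _) = at-beyond x ℕP.≤-refl

  Y-top : ∀ p → Y p (suc m) ≡ 0ℚ
  Y-top (_ , y , _) = at-beyond y ℕP.≤-refl

  cForm-zero : ∀ p → cForm p 0 ≡ 0ℚ
  cForm-zero p = solve 1 (λ a → (con 0ℚ :* a :+ con 0ℚ) :- con 0ℚ := con 0ℚ) refl (Z p + ι (suc m))

  cForm-one : ∀ p → cForm p 1 ≡ (Z p + ι m) - Y p 1
  cForm-one p = solve 2 (λ a y → (con 1ℚ :* a :+ con 0ℚ) :- (con 0ℚ :+ y) := a :- y) refl (Z p + ι m) (Y p 1)

  cForm-step : ∀ p j → j ℕ.≤ m →
    cForm p (suc j) - cForm p j ≡ ((Z p + ι m) - (ι j + ι j)) + X p (suc m ∸ j) - Y p (suc j)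
  cForm-step p j j≤m = begin
    ((ι (suc j) * (Z p + ι (m ∸ j)) + SX j) - (SY j + Y p (suc j))) - ((ι j * (Z p + ι (suc m ∸ j)) + SX (j ∸ 1)) - SY j)
      ≡⟨ cong₃ (λ a b c → ((a * (Z p + ι (m ∸ j)) + c) - (SY j + Y p (suc j))) - ((ι j * (Z p + b) + SX (j ∸ 1)) - SY j))
               (ι-+ 1 j) (trans (cong ι (ℕP.+-∸-assoc 1 j≤m)) (ι-+ 1 (m ∸ j))) (SX-step j) ⟩
    (((1ℚ + ι j) * (Z p + K) + (SX (j ∸ 1) + X p (suc m ∸ j))) - (SY j + Y p (suc j))) - ((ι j * (Z p + (1ℚ + K)) + SX (j ∸ 1)) - SY j)
      ≡⟨ solve 7 (λ ij z k s x sy y →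
            (((con 1ℚ :+ ij) :* (z :+ k) :+ (s :+ x)) :- (sy :+ y)) :- ((ij :* (z :+ (con 1ℚ :+ k)) :+ s) :- sy)
            := ((z :+ (k :+ ij)) :- (ij :+ ij)) :+ x :- y)
           refl (ι j) (Z p) K (SX (j ∸ 1)) (X p (suc m ∸ j)) (SY j) (Y p (suc j)) ⟩
    ((Z p + (K + ι j)) - (ι j + ι j)) + X p (suc m ∸ j) - Y p (suc j)
      ≡⟨ cong (λ a → ((Z p + a) - (ι j + ι j)) + X p (suc m ∸ j) - Y p (suc j))
              (trans (sym (ι-+ (m ∸ j) j)) (cong ι (ℕP.m∸n+n≡m j≤m))) ⟩
    ((Z p + ι m) - (ι j + ι j)) + X p (suc m ∸ j) - Y p (suc j) ∎
    where
    open ≡-Reasoning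
    K = ι (m ∸ j)
    SX SY : ℕ → ℚ
    SX n = sumTo n (λ i → X p (m ∸ i))
    SY n = sumTo n (λ i → Y p (suc i))
    SX-step : ∀ j → SX j ≡ SX (j ∸ 1) + X p (suc m ∸ j)
    SX-step zero    = sym (trans (cong (_+_ 0ℚ) (X-top p)) (ℚP.+-identityʳ 0ℚ))
    SX-step (suc j) = refl

  secondDiff-cForm : ∀ p i → i ℕ.< m → secondDiff (cForm p) i ≡ (1ℚ + 1ℚ) - slack A p i - slack B p i
  secondDiff-cForm p i i<m = begin
    (c₁ + c₁) - c₀ - c₂
      ≡⟨ solve 3 (λ c₀ c₁ c₂ → (c₁ :+ c₁) :- c₀ :- c₂ := (c₁ :- c₀) :- (c₂ :- c₁)) refl c₀ c₁ c₂ ⟩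
    (c₁ - c₀) - (c₂ - c₁)
      ≡⟨ cong₂ _-_ (cForm-step p i (ℕP.<⇒≤ i<m)) (cForm-step p (suc i) i<m) ⟩
    (((Z p + ι m) - (ι i + ι i)) + X p (suc m ∸ i) - Y p (suc i))
      - (((Z p + ι m) - (ι (suc i) + ι (suc i))) + X p (m ∸ i) - Y p (suc (suc i)))
      ≡⟨ cong₂ (λ a b → (((Z p + ι m) - (ι i + ι i)) + X p a - Y p (suc i))
                          - (((Z p + ι m) - (b + b)) + X p (m ∸ i) - Y p (suc (suc i))))
               (ℕP.+-∸-assoc 1 (ℕP.<⇒≤ i<m)) (ι-+ 1 i) ⟩
    (((Z p + ι m) - (ι i + ι i)) + X p (suc (m ∸ i)) - Y p (suc i))
      - (((Z p + ι m) - ((1ℚ + ι i) + (1ℚ + ι i))) + X p (m ∸ i) - Y p (suc (suc i)))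
      ≡⟨ solve 6 (λ a ii x₁ y₁ x₀ y₂ →
            ((a :- (ii :+ ii)) :+ x₁ :- y₁) :- ((a :- ((con 1ℚ :+ ii) :+ (con 1ℚ :+ ii))) :+ x₀ :- y₂)
            := (con 1ℚ :+ con 1ℚ) :- (x₀ :- x₁) :- (y₁ :- y₂))
           refl (Z p + ι m) (ι i) (X p (suc (m ∸ i))) (Y p (suc i)) (X p (m ∸ i)) (Y p (suc (suc i))) ⟩
    (1ℚ + 1ℚ) - slack A p i - slack B p i ∎
    where
    open ≡-Reasoning
    c₀ = cForm p i
    c₁ = cForm p (suc i)
    c₂ = cForm p (suc (suc i))

  cForm-top : ∀ p → cForm p (suc m) ≡ Z p * ι (suc m) - (sumTo m (Y p ∘ suc) - sumTo m (X p ∘ suc))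
  cForm-top p = begin
    (ι (suc m) * (Z p + ι (m ∸ m)) + sumTo m (λ i → X p (m ∸ i))) - (SY + Y p (suc m))
      ≡⟨ cong₂ (λ a b → (ι (suc m) * (Z p + ι a) + b) - (SY + Y p (suc m))) (ℕP.n∸n≡0 m) (sumTo-reverse m (X p)) ⟩
    (ι (suc m) * (Z p + 0ℚ) + SX) - (SY + Y p (suc m))
      ≡⟨ cong (λ a → (ι (suc m) * (Z p + 0ℚ) + SX) - (SY + a)) (Y-top p) ⟩
    (ι (suc m) * (Z p + 0ℚ) + SX) - (SY + 0ℚ)
      ≡⟨ solve 4 (λ a z s t → (a :* (z :+ con 0ℚ) :+ s) :- (t :+ con 0ℚ) := z :* a :- (t :- s)) refl (ι (suc m)) (Z p) SX SY ⟩
    Z p * ι (suc m) - (SY - SX) ∎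
    where
    open ≡-Reasoning
    SX = sumTo m (X p ∘ suc)
    SY = sumTo m (Y p ∘ suc)

  equation⇒cForm-top≡0 : ∀ p → sumTo m (Y p ∘ suc) - sumTo m (X p ∘ suc) ≡ Z p * ι (suc m) → cForm p (suc m) ≡ 0ℚ
  equation⇒cForm-top≡0 p e = trans (cForm-top p) (trans (cong (_-_ (Z p * ι (suc m))) e) (ℚP.+-inverseʳ (Z p * ι (suc m))))

  cForm-top≡0⇒equation : ∀ p → cForm p (suc m) ≡ 0ℚ → sumTo m (Y p ∘ suc) - sumTo m (X p ∘ suc) ≡ Z p * ι (suc m)
  cForm-top≡0⇒equation p e = q-p≡0⇒p≡q (trans (sym (cForm-top p)) e)

  Feasible : Point m → Set
  Feasible p = cForm p (suc m) ≡ 0ℚ × (∀ f i → i ℕ.< m → 0ℚ ≤ slack f p i)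

  coordinate-decrements-nonNeg : ∀ {p} → Feasible p →
    (∀ k → k ℕ.< m → 0ℚ ≤ decrement (X p ∘ suc) k) × (∀ k → k ℕ.< m → 0ℚ ≤ decrement (Y p ∘ suc) k)
  coordinate-decrements-nonNeg {p} (_ , slack≥0) =
    ∀<-∸⇒∀<-suc (λ k → 0ℚ ≤ decrement (X p) k) m (slack≥0 A) , slack≥0 B

  InP⇒Feasible : ∀ p → InP (suc (suc m)) p → Feasible p
  InP⇒Feasible p (antitone , nonNeg , cForm≥0 , equation) = equation⇒cForm-top≡0 p equation , slack≥0
    where
    slack≥0 : ∀ f i → i ℕ.< m → 0ℚ ≤ slack f p i
    slack≥0 A = ∀<-suc⇒∀<-∸ (λ k → 0ℚ ≤ decrement (X p) k) m
      (antitoneNonNeg⇒decrements m (X p) (X-top p) ((λ j a b → proj₁ (antitone j a b)) , (λ j a b → proj₁ (nonNeg j a b))))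
    slack≥0 B = antitoneNonNeg⇒decrements m (Y p) (Y-top p) ((λ j a b → proj₂ (antitone j a b)) , (λ j a b → proj₂ (nonNeg j a b)))
    slack≥0 C i = cForm≥0 (suc i) (s≤s z≤n)

  Feasible⇒InP : ∀ p → Feasible p → InP (suc (suc m)) p
  Feasible⇒InP p p-feasible@(top , slack≥0) =
    (λ j a b → proj₁ X-ok j a b , proj₁ Y-ok j a b) , (λ j a b → proj₂ X-ok j a b , proj₂ Y-ok j a b) ,
    (λ { (suc i) _ i<m → slack≥0 C i i<m }) , cForm-top≡0⇒equation p top
    where
    X-ok = decrements⇒antitoneNonNeg m (X p) (X-top p) (proj₁ (coordinate-decrements-nonNeg p-feasible))
    Y-ok = decrements⇒antitoneNonNeg m (Y p) (Y-top p) (proj₂ (coordinate-decrements-nonNeg p-feasible))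

  cForm-nonNeg : ∀ {p} → Feasible p → ∀ j → j ℕ.≤ suc m → 0ℚ ≤ cForm p j
  cForm-nonNeg {p} (top , slack≥0) zero    _         = ℚP.≤-reflexive (sym (cForm-zero p))
  cForm-nonNeg {p} (top , slack≥0) (suc i) (s≤s i≤m) =
    [ slack≥0 C i , (λ i≡m → ℚP.≤-reflexive (sym (subst (λ j → cForm p (suc j) ≡ 0ℚ) (sym i≡m) top))) ]′
    (ℕP.m≤n⇒m<n∨m≡n i≤m)

  slackA+slackB : ∀ p i → i ℕ.< m → slack A p i + slack B p i ≡ (1ℚ + 1ℚ) - secondDiff (cForm p) i
  slackA+slackB p i i<m = trans
    (solve 3 (λ a b c → a :+ b := c :- (c :- a :- b)) refl (slack A p i) (slack B p i) (1ℚ + 1ℚ))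
    (cong (_-_ (1ℚ + 1ℚ)) (sym (secondDiff-cForm p i i<m)))

  Z≡cForm₁+Y₁-m : ∀ p → Z p ≡ (cForm p 1 + Y p 1) - ι m
  Z≡cForm₁+Y₁-m p = trans (solve 3 (λ z a y → z := (((z :+ a) :- y) :+ y) :- a) refl (Z p) (ι m) (Y p 1))
                          (cong (λ c → (c + Y p 1) - ι m) (sym (cForm-one p)))

  ≈P-from-slacks : ∀ q r → (∀ f i → i ℕ.< m → slack f q i ≡ slack f r i) → cForm q 1 ≡ cForm r 1 → q ≈P r
  ≈P-from-slacks q@(xq , yq , _) r@(xr , yr , _) slack≡ cForm₁≡ = coordinates X≡ , coordinates Y≡ , Z≡
    where
    X≡ : ∀ k → k ℕ.≤ m → X q (suc k) ≡ X r (suc k)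
    X≡ = ≡-from-decrements (X q ∘ suc) (X r ∘ suc) (trans (X-top q) (sym (X-top r)))
           (∀<-∸⇒∀<-suc (λ k → decrement (X q) k ≡ decrement (X r) k) m (slack≡ A))
    Y≡ : ∀ k → k ℕ.≤ m → Y q (suc k) ≡ Y r (suc k)
    Y≡ = ≡-from-decrements (Y q ∘ suc) (Y r ∘ suc) (trans (Y-top q) (sym (Y-top r))) (slack≡ B)
    coordinates : ∀ {u v : Fin m → ℚ} → (∀ k → k ℕ.≤ m → at u (suc k) ≡ at v (suc k)) → ∀ i → u i ≡ v i
    coordinates {u} {v} e i = trans (sym (at-toℕ u i)) (trans (e (toℕ i) (ℕP.<⇒≤ (FinP.toℕ<n i))) (at-toℕ v i))
    Z≡ : Z q ≡ Z r
    Z≡ = trans (Z≡cForm₁+Y₁-m q) (trans (cong₂ (λ c y → (c + y) - ι m) cForm₁≡ (Y≡ 0 z≤n)) (sym (Z≡cForm₁+Y₁-m r)))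

  Tight : (ℕ → Family) → Point m → Set
  Tight w p = ∀ f i → i ℕ.< m → f ≢ w i → slack f p i ≡ 0ℚ

  tight-zero : ∀ {w p} → Tight w p → ∀ f {g} i → i ℕ.< m → w i ≡ g → f ≢ g → slack f p i ≡ 0ℚ
  tight-zero p-tight f i i<m wᵢ≡g f≢g = p-tight f i i<m (λ f≡wᵢ → f≢g (trans f≡wᵢ wᵢ≡g))

  tight-cForm-unique : ∀ w {q r} → cForm q (suc m) ≡ 0ℚ → cForm r (suc m) ≡ 0ℚ → Tight w q → Tight w r →
                       ∀ j → j ℕ.≤ suc m → cForm q j ≡ cForm r j
  tight-cForm-unique w {q} {r} q-top r-top q-tight r-tight j j≤1+m = sym (q-p≡0⇒p≡q
    (zero-or-harmonic⇒zero m δ (cong₂ _-_ (cForm-zero q) (cForm-zero r)) (cong₂ _-_ q-top r-top) zero-or-harmonic j j≤1+m))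
    where
    δ : ℕ → ℚ
    δ j = cForm q j - cForm r j
    zero-or-harmonic : ∀ i → i ℕ.< m → δ (suc i) ≡ 0ℚ ⊎ secondDiff δ i ≡ 0ℚ
    zero-or-harmonic i i<m = at-letter (w i) refl
      where
      zero-at : ∀ {p} → Tight w p → ∀ f {g} → w i ≡ g → f ≢ g → slack f p i ≡ 0ℚ
      zero-at p-tight f = tight-zero p-tight f i i<m
      at-letter : ∀ l → w i ≡ l → δ (suc i) ≡ 0ℚ ⊎ secondDiff δ i ≡ 0ℚ
      at-letter A wᵢ≡A = inj₁ (cong₂ _-_ (zero-at q-tight C wᵢ≡A λ ()) (zero-at r-tight C wᵢ≡A λ ()))
      at-letter B wᵢ≡B = inj₁ (cong₂ _-_ (zero-at q-tight C wᵢ≡B λ ()) (zero-at r-tight C wᵢ≡B λ ()))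
      at-letter C wᵢ≡C = inj₂ (begin
        secondDiff δ i
          ≡⟨ secondDiff-sub (cForm q) (cForm r) i ⟩
        secondDiff (cForm q) i - secondDiff (cForm r) i
          ≡⟨ cong₂ _-_ (secondDiff-cForm q i i<m) (secondDiff-cForm r i i<m) ⟩
        ((1ℚ + 1ℚ) - slack A q i - slack B q i) - ((1ℚ + 1ℚ) - slack A r i - slack B r i)
          ≡⟨ cong₂ _-_ (cong₂ (λ a b → (1ℚ + 1ℚ) - a - b) (zero-at q-tight A wᵢ≡C λ ()) (zero-at q-tight B wᵢ≡C λ ()))
                       (cong₂ (λ a b → (1ℚ + 1ℚ) - a - b) (zero-at r-tight A wᵢ≡C λ ()) (zero-at r-tight B wᵢ≡C λ ())) ⟩
        ((1ℚ + 1ℚ) - 0ℚ - 0ℚ) - ((1ℚ + 1ℚ) - 0ℚ - 0ℚ)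
          ≡⟨ ℚP.+-inverseʳ ((1ℚ + 1ℚ) - 0ℚ - 0ℚ) ⟩
        0ℚ ∎)
        where open ≡-Reasoning

  tight-unique : ∀ w {q r} → cForm q (suc m) ≡ 0ℚ → cForm r (suc m) ≡ 0ℚ → Tight w q → Tight w r → q ≈P r
  tight-unique w {q} {r} q-top r-top q-tight r-tight = ≈P-from-slacks q r slack≡ (cForm≡ 1 (s≤s z≤n))
    where
    cForm≡ = tight-cForm-unique w q-top r-top q-tight r-tight
    A-or-B-tight : ∀ i → i ℕ.< m → (slack A q i ≡ 0ℚ × slack A r i ≡ 0ℚ) ⊎ (slack B q i ≡ 0ℚ × slack B r i ≡ 0ℚ)
    A-or-B-tight i i<m = at-letter (w i) refl
      where
      at-letter : ∀ l → w i ≡ l → (slack A q i ≡ 0ℚ × slack A r i ≡ 0ℚ) ⊎ (slack B q i ≡ 0ℚ × slack B r i ≡ 0ℚ)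
      at-letter A wᵢ≡A = inj₂ (tight-zero q-tight B i i<m wᵢ≡A (λ ()) , tight-zero r-tight B i i<m wᵢ≡A (λ ()))
      at-letter B wᵢ≡B = inj₁ (tight-zero q-tight A i i<m wᵢ≡B (λ ()) , tight-zero r-tight A i i<m wᵢ≡B (λ ()))
      at-letter C wᵢ≡C = inj₁ (tight-zero q-tight A i i<m wᵢ≡C (λ ()) , tight-zero r-tight A i i<m wᵢ≡C (λ ()))
    AB≡ : ∀ i → i ℕ.< m → slack A q i ≡ slack A r i × slack B q i ≡ slack B r i
    AB≡ i i<m = sum-split
      (trans (slackA+slackB q i i<m)
        (trans (cong (_-_ (1ℚ + 1ℚ)) (cong₃ (λ a b c → (b + b) - a - c)
                  (cForm≡ i (ℕP.≤-trans (ℕP.<⇒≤ i<m) (ℕP.n≤1+n m))) (cForm≡ (suc i) (s≤s (ℕP.<⇒≤ i<m)))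
                  (cForm≡ (suc (suc i)) (s≤s i<m))))
               (sym (slackA+slackB r i i<m))))
      (A-or-B-tight i i<m)
    slack≡ : ∀ f i → i ℕ.< m → slack f q i ≡ slack f r i
    slack≡ A i i<m = proj₁ (AB≡ i i<m)
    slack≡ B i i<m = proj₂ (AB≡ i i<m)
    slack≡ C i i<m = cForm≡ (suc i) (s≤s (ℕP.<⇒≤ i<m))

  tight-feasible⇒vertex : ∀ w {v} → Feasible v → Tight w v → IsVertex (suc (suc m)) v
  tight-feasible⇒vertex w {v} v-feasible v-tight = Feasible⇒InP v v-feasible , extreme
    where
    extreme : ∀ q r t → InP (suc (suc m)) q → InP (suc (suc m)) r → 0ℚ < t → t < 1ℚ → v ≈P comb t q r → q ≈P r
    extreme q r t q∈P r∈P t>0 t<1 v≈comb =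
      tight-unique w (proj₁ q-feasible) (proj₁ r-feasible) (λ f i i<m f≢wᵢ → proj₁ (both-zero f i i<m f≢wᵢ))
                                                         (λ f i i<m f≢wᵢ → proj₂ (both-zero f i i<m f≢wᵢ))
      where
      q-feasible = InP⇒Feasible q q∈P
      r-feasible = InP⇒Feasible r r∈P
      both-zero : ∀ f i → i ℕ.< m → f ≢ w i → slack f q i ≡ 0ℚ × slack f r i ≡ 0ℚ
      both-zero f i i<m f≢wᵢ = comb≡0⇒≡0 t>0 t<1 (proj₂ q-feasible f i i<m) (proj₂ r-feasible f i i<m)
        (trans (sym (comb-homo (affine-slack f i) t q r))
               (trans (sym (resp-≈P (affine-slack f i) v≈comb)) (v-tight f i i<m f≢wᵢ)))

  comb-Feasible : ∀ t {p q} → cForm p (suc m) ≡ 0ℚ → cForm q (suc m) ≡ 0ℚ →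
    (∀ f i → i ℕ.< m → 0ℚ ≤ t * slack f p i + (1ℚ - t) * slack f q i) → Feasible (comb t p q)
  comb-Feasible t {p} {q} p-top q-top comb≥0 =
    trans (comb-homo (affine-cForm (suc m)) t p q)
      (trans (cong₂ (λ a b → t * a + (1ℚ - t) * b) p-top q-top)
             (solve 1 (λ t → t :* con 0ℚ :+ (con 1ℚ :- t) :* con 0ℚ := con 0ℚ) refl t)) ,
    λ f i i<m → subst (0ℚ ≤_) (sym (comb-homo (affine-slack f i) t p q)) (comb≥0 f i i<m)

  scale-below-slacks : ∀ {p v} → Feasible p → Feasible v → (∀ f i → i ℕ.< m → slack f p i ≡ 0ℚ → slack f v i ≡ 0ℚ) →
    ∃ λ s → 0ℚ < s × s ≤ 1ℚ × (∀ f i → i ℕ.< m → s * slack f v i ≤ slack f p i)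
  scale-below-slacks {p} {v} (_ , p-slack≥0) (_ , v-slack≥0) support =
    let (s , s>0 , s≤1 , below) = uniform-scale-below (cartesianProduct families (upTo m))
                                    (λ (f , i) → slack f p i) (λ (f , i) → slack f v i) hypotheses
    in s , s>0 , s≤1 , λ f i i<m → below (∈-cartesianProduct⁺ (∈-families f) (∈-upTo⁺ i<m))
    where
    hypotheses : ∀ {k} → k ∈ cartesianProduct families (upTo m) →
                 0ℚ ≤ slack (proj₁ k) p (proj₂ k) × 0ℚ ≤ slack (proj₁ k) v (proj₂ k) ×
                 (slack (proj₁ k) p (proj₂ k) ≡ 0ℚ → slack (proj₁ k) v (proj₂ k) ≡ 0ℚ)
    hypotheses {f , i} k∈ = p-slack≥0 f i i<m , v-slack≥0 f i i<m , support f i i<m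
      where i<m = ∈-upTo⁻ (proj₂ (∈-cartesianProduct⁻ families (upTo m) k∈))

  vertex-≈P-by-support : ∀ {p v} → IsVertex (suc (suc m)) p → Feasible v →
    (∀ f i → i ℕ.< m → slack f p i ≡ 0ℚ → slack f v i ≡ 0ℚ) → p ≈P v
  vertex-≈P-by-support {p} {v} (p∈P , p-extreme) v-feasible@(v-top , v-slack≥0) support =
    (λ i → extrapolation-cancel s>0 (proj₁ q≈r i)) , (λ i → extrapolation-cancel s>0 (proj₁ (proj₂ q≈r) i)) ,
    extrapolation-cancel s>0 (proj₂ (proj₂ q≈r))
    where
    p-feasible = InP⇒Feasible p p∈P
    p-top = proj₁ p-feasible
    p-slack≥0 = proj₂ p-feasible
    scale = scale-below-slacks p-feasible v-feasible support
    s = proj₁ scale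
    s>0 = proj₁ (proj₂ scale)
    s≤1 = proj₁ (proj₂ (proj₂ scale))
    sv≤p = proj₂ (proj₂ (proj₂ scale))
    q-feasible : Feasible (comb s v p)
    q-feasible = comb-Feasible s v-top p-top (λ f i i<m →
      +-nonNeg (*-nonNeg (ℚP.<⇒≤ s>0) (v-slack≥0 f i i<m)) (*-nonNeg (p≤q⇒0≤q-p s≤1) (p-slack≥0 f i i<m)))
    r-feasible : Feasible (comb (1ℚ + s) p v)
    r-feasible = comb-Feasible (1ℚ + s) p-top v-top (λ f i i<m → subst (0ℚ ≤_)
      (solve 3 (λ s a b → (a :- s :* b) :+ s :* a := (con 1ℚ :+ s) :* a :+ (con 1ℚ :- (con 1ℚ :+ s)) :* b)
             refl s (slack f p i) (slack f v i))
      (+-nonNeg (p≤q⇒0≤q-p (sv≤p f i i<m)) (*-nonNeg (ℚP.<⇒≤ s>0) (p-slack≥0 f i i<m))))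
    p≈midpoint : p ≈P comb ½ (comb s v p) (comb (1ℚ + s) p v)
    p≈midpoint = (λ i → extrapolation-midpoint s (proj₁ p i) (proj₁ v i)) ,
                 (λ i → extrapolation-midpoint s (proj₁ (proj₂ p) i) (proj₁ (proj₂ v) i)) ,
                 extrapolation-midpoint s (proj₂ (proj₂ p)) (proj₂ (proj₂ v))
    q≈r = p-extreme (comb s v p) (comb (1ℚ + s) p v) ½ (Feasible⇒InP _ q-feasible) (Feasible⇒InP _ r-feasible)
                    (ℚP.positive⁻¹ ½) (toWitness {a? = ½ ℚP.<? 1ℚ} _) p≈midpoint

  letter : Point m → ℕ → Family
  letter p i = nonzeroFamily (λ f → slack f p i)

  slack-letter≢0 : ∀ {p} → Feasible p → ∀ i → i ℕ.< m → slack (letter p i) p i ≢ 0ℚ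
  slack-letter≢0 {p} p-feasible i i<m = nonzeroFamily-≢0 (λ f → slack f p i) λ c≡0 b≡0 a≡0 →
    two≢0 (nonNeg+nonNeg≡0⇒≡0 (ℚP.nonNegative⁻¹ (1ℚ + 1ℚ))
      (+-nonNeg (cForm-nonNeg p-feasible i (ℕP.≤-trans (ℕP.<⇒≤ i<m) (ℕP.n≤1+n m)))
                (cForm-nonNeg p-feasible (suc (suc i)) (s≤s i<m)))
      (begin
        (1ℚ + 1ℚ) + (c₀ + c₂)
          ≡⟨ solve 2 (λ c₀ c₂ → (con 1ℚ :+ con 1ℚ) :+ (c₀ :+ c₂)
                                := ((con 1ℚ :+ con 1ℚ) :- con 0ℚ :- con 0ℚ) :- ((con 0ℚ :+ con 0ℚ) :- c₀ :- c₂)) refl c₀ c₂ ⟩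
        ((1ℚ + 1ℚ) - 0ℚ - 0ℚ) - ((0ℚ + 0ℚ) - c₀ - c₂)
          ≡⟨ cong₃ (λ a b c → ((1ℚ + 1ℚ) - a - b) - ((c + c) - c₀ - c₂)) (sym a≡0) (sym b≡0) (sym c≡0) ⟩
        ((1ℚ + 1ℚ) - slack A p i - slack B p i) - secondDiff (cForm p) i
          ≡⟨ cong (_-_ ((1ℚ + 1ℚ) - slack A p i - slack B p i)) (secondDiff-cForm p i i<m) ⟩
        ((1ℚ + 1ℚ) - slack A p i - slack B p i) - ((1ℚ + 1ℚ) - slack A p i - slack B p i)
          ≡⟨ ℚP.+-inverseʳ ((1ℚ + 1ℚ) - slack A p i - slack B p i) ⟩
        0ℚ ∎))
    where
    open ≡-Reasoning
    c₀ = cForm p i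
    c₂ = cForm p (suc (suc i))
    two≢0 : 1ℚ + 1ℚ ≢ 0ℚ
    two≢0 ()

  cForm-m : ∀ p → cForm p (suc m) ≡ 0ℚ → cForm p m ≡ (ι m - Z p) - X p 1
  cForm-m p top = begin
    cForm p m
      ≡⟨ solve 2 (λ c s → c := s :- (s :- c)) refl (cForm p m) (cForm p (suc m)) ⟩
    cForm p (suc m) - (cForm p (suc m) - cForm p m)
      ≡⟨ cong₂ _-_ top (cForm-step p m ℕP.≤-refl) ⟩
    0ℚ - (((Z p + ι m) - (ι m + ι m)) + X p (suc m ∸ m) - Y p (suc m))
      ≡⟨ cong₂ (λ a b → 0ℚ - (((Z p + ι m) - (ι m + ι m)) + X p a - b)) (ℕP.m+n∸n≡m 1 m) (Y-top p) ⟩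
    0ℚ - (((Z p + ι m) - (ι m + ι m)) + X p 1 - 0ℚ)
      ≡⟨ solve 3 (λ z mm x → con 0ℚ :- (((z :+ mm) :- (mm :+ mm)) :+ x :- con 0ℚ) := (mm :- z) :- x) refl (Z p) (ι m) (X p 1) ⟩
    (ι m - Z p) - X p 1 ∎
    where open ≡-Reasoning

  leading-coordinates-bounded : ∀ {p} → Feasible p →
    X p 1 ≤ ι m + ι m × Y p 1 ≤ ι m + ι m × ℚ.∣ Z p ∣ ≤ ι m + ι m
  leading-coordinates-bounded {p} p-feasible@(top , _) =
    0≤q-p⇒p≤q (subst (0ℚ ≤_)
      (solve 4 (λ m z x y → ((m :- z) :- x) :+ ((z :+ m) :- y) :+ y := (m :+ m) :- x) refl (ι m) (Z p) (X p 1) (Y p 1))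
      (+-nonNeg (+-nonNeg cₘ≥0 c₁≥0) Y₁≥0)) ,
    0≤q-p⇒p≤q (subst (0ℚ ≤_)
      (solve 4 (λ m z x y → ((m :- z) :- x) :+ ((z :+ m) :- y) :+ x := (m :+ m) :- y) refl (ι m) (Z p) (X p 1) (Y p 1))
      (+-nonNeg (+-nonNeg cₘ≥0 c₁≥0) X₁≥0)) ,
    ∣p∣≤q
      (subst (0ℚ ≤_) (solve 3 (λ m z y → ((z :+ m) :- y) :+ y :+ m := z :+ (m :+ m)) refl (ι m) (Z p) (Y p 1))
        (+-nonNeg (+-nonNeg c₁≥0 Y₁≥0) (0≤ι m)))
      (0≤q-p⇒p≤q (subst (0ℚ ≤_) (solve 3 (λ m z x → ((m :- z) :- x) :+ x :+ m := (m :+ m) :- z) refl (ι m) (Z p) (X p 1))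
        (+-nonNeg (+-nonNeg cₘ≥0 X₁≥0) (0≤ι m))))
    where
    c₁≥0 = subst (0ℚ ≤_) (cForm-one p) (cForm-nonNeg p-feasible 1 (s≤s z≤n))
    cₘ≥0 = subst (0ℚ ≤_) (cForm-m p top) (cForm-nonNeg p-feasible m (ℕP.n≤1+n m))
    X₁≥0 = nonNeg-from-decrements (X p ∘ suc) (X-top p) (proj₁ (coordinate-decrements-nonNeg p-feasible)) 0 z≤n
    Y₁≥0 = nonNeg-from-decrements (Y p ∘ suc) (Y-top p) (proj₂ (coordinate-decrements-nonNeg p-feasible)) 0 z≤n

  bounded : Bounded (suc (suc m))
  bounded = ι m + ι m , λ x y z p∈P → box (x , y , z) (InP⇒Feasible (x , y , z) p∈P)
    where
    box : ∀ p → Feasible p → (∀ i → ℚ.∣ proj₁ p i ∣ ≤ ι m + ι m) × (∀ i → ℚ.∣ proj₁ (proj₂ p) i ∣ ≤ ι m + ι m)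
                            × (ℚ.∣ Z p ∣ ≤ ι m + ι m)
    box p@(x , y , _) p-feasible =
      let (X₁≤2m , Y₁≤2m , Z-bound) = leading-coordinates-bounded p-feasible
          (X-decrements , Y-decrements) = coordinate-decrements-nonNeg p-feasible
      in coordinate x X-decrements X₁≤2m , coordinate y Y-decrements Y₁≤2m , Z-bound
      where
      coordinate : ∀ (v : Fin m → ℚ) → (∀ k → k ℕ.< m → 0ℚ ≤ decrement (at v ∘ suc) k) → at v 1 ≤ ι m + ι m →
                   ∀ i → ℚ.∣ v i ∣ ≤ ι m + ι m
      coordinate v decrements v₁≤2m i = subst (λ a → ℚ.∣ a ∣ ≤ ι m + ι m) (at-toℕ v i)
        (∣p∣≤q (+-nonNeg vᵢ≥0 (+-nonNeg (0≤ι m) (0≤ι m)))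
               (ℚP.≤-trans (decrements-nonNeg⇒≤-head (at v ∘ suc) decrements (toℕ i) i≤m) v₁≤2m))
        where
        i≤m = ℕP.<⇒≤ (FinP.toℕ<n i)
        vᵢ≥0 = nonNeg-from-decrements (at v ∘ suc) (at-beyond v ℕP.≤-refl) decrements (toℕ i) i≤m

-- The vertex of a word

extend : Family → ℕ → ℕ
extend A _ = 0
extend B _ = 0
extend C k = suc k

extend-nonC : ∀ f n → f ≢ C → extend f n ≡ 0
extend-nonC A n _   = refl
extend-nonC B n _   = refl
extend-nonC C n f≢C = ⊥-elim (f≢C refl)

run-identity : ∀ p q → p ℕ.* suc (suc q) ℕ.+ suc (suc p) ℕ.* q ℕ.+ 2 ≡ suc p ℕ.* suc q ℕ.+ suc p ℕ.* suc q
run-identity = solveℕ 2 (λ p q → p ⊗ (κ 2 ⊕ q) ⊕ (κ 2 ⊕ p) ⊗ q ⊕ κ 2 ≐ (κ 1 ⊕ p) ⊗ (κ 1 ⊕ q) ⊕ (κ 1 ⊕ p) ⊗ (κ 1 ⊕ q)) refl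
  where open ℕ-Solver.+-*-Solver using () renaming (solve to solveℕ; _:+_ to _⊕_; _:*_ to _⊗_; con to κ; _:=_ to _≐_)

only : Family → Family → ℕ → ℕ
only A A n = n
only B B n = n
only C C n = n
only _ _ _ = 0

only-≢ : ∀ f g n → f ≢ g → only f g n ≡ 0
only-≢ A A n f≢g = ⊥-elim (f≢g refl)
only-≢ A B n _   = refl
only-≢ A C n _   = refl
only-≢ B A n _   = refl
only-≢ B B n f≢g = ⊥-elim (f≢g refl)
only-≢ B C n _   = refl
only-≢ C A n _   = refl
only-≢ C B n _   = refl
only-≢ C C n f≢g = ⊥-elim (f≢g refl)

decode : ℕ → ℕ → Family
decode (suc _) _       = A
decode zero    (suc _) = B
decode zero    zero    = C

ι-secondDiff : ∀ (c : ℕ → ℕ) i a b → c i ℕ.+ c (suc (suc i)) ℕ.+ 2 ≡ c (suc i) ℕ.+ c (suc i) ℕ.+ a ℕ.+ b →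
               secondDiff (ι ∘ c) i ≡ (1ℚ + 1ℚ) - ι a - ι b
ι-secondDiff c i a b e = begin
  (ι c₁ + ι c₁) - ι c₀ - ι c₂
    ≡⟨ solve 6 (λ c₀ c₁ c₂ a b two → (c₁ :+ c₁) :- c₀ :- c₂ := two :- a :- b :+ ((((c₁ :+ c₁) :+ a) :+ b) :- ((c₀ :+ c₂) :+ two)))
             refl (ι c₀) (ι c₁) (ι c₂) (ι a) (ι b) (1ℚ + 1ℚ) ⟩
  (1ℚ + 1ℚ) - ι a - ι b + ((((ι c₁ + ι c₁) + ι a) + ι b) - ((ι c₀ + ι c₂) + (1ℚ + 1ℚ)))
    ≡⟨ cong (λ d → (1ℚ + 1ℚ) - ι a - ι b + d) (trans (cong₂ _-_ (sym right) (sym left)) (cong (_- ι (c₀ ℕ.+ c₂ ℕ.+ 2)) (cong ι (sym e)))) ⟩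
  (1ℚ + 1ℚ) - ι a - ι b + (ι (c₀ ℕ.+ c₂ ℕ.+ 2) - ι (c₀ ℕ.+ c₂ ℕ.+ 2))
    ≡⟨ solve 2 (λ x d → x :+ (d :- d) := x) refl ((1ℚ + 1ℚ) - ι a - ι b) (ι (c₀ ℕ.+ c₂ ℕ.+ 2)) ⟩
  (1ℚ + 1ℚ) - ι a - ι b ∎
  where
  open ≡-Reasoning
  c₀ = c i
  c₁ = c (suc i)
  c₂ = c (suc (suc i))
  left : ι (c₀ ℕ.+ c₂ ℕ.+ 2) ≡ (ι c₀ + ι c₂) + (1ℚ + 1ℚ)
  left = trans (ι-+ (c₀ ℕ.+ c₂) 2) (cong₂ _+_ (ι-+ c₀ c₂) (ι-+ 1 1))
  right : ι (c₁ ℕ.+ c₁ ℕ.+ a ℕ.+ b) ≡ ((ι c₁ + ι c₁) + ι a) + ι b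
  right = trans (ι-+ (c₁ ℕ.+ c₁ ℕ.+ a) b) (cong (_+ ι b) (trans (ι-+ (c₁ ℕ.+ c₁) a) (cong (_+ ι a) (ι-+ c₁ c₁))))

module Vertex (m : ℕ) (w : ℕ → Family) where
  open Polytope m

  runBelow : ℕ → ℕ
  runBelow zero    = 0
  runBelow (suc i) = extend (w i) (runBelow i)

  runAbove : ℕ → ℕ → ℕ
  runAbove zero    i = 0
  runAbove (suc n) i = extend (w i) (runAbove n (suc i))

  runAbove-step : ∀ i → i ℕ.< m → runAbove (m ∸ i) i ≡ extend (w i) (runAbove (m ∸ suc i) (suc i))
  runAbove-step i i<m = cong (λ n → runAbove n i) (ℕP.+-∸-assoc 1 i<m)

  -- If the triples strictly between L and R carry C while L and R do not (or are −1 and m), then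
  -- cValue (suc i) = (i − L)(R − i) for L < i < R: zero at the ends of the run, secondDiff 2 inside.
  cValue : ℕ → ℕ
  cValue zero    = 0
  cValue (suc i) = runBelow (suc i) ℕ.* runAbove (m ∸ i) i

  cValue-top : cValue (suc m) ≡ 0
  cValue-top = trans (cong (λ n → runBelow (suc m) ℕ.* runAbove n m) (ℕP.n∸n≡0 m)) (ℕP.*-zeroʳ (runBelow (suc m)))

  cValue-nonC : ∀ i → w i ≢ C → cValue (suc i) ≡ 0
  cValue-nonC i wᵢ≢C = cong (ℕ._* runAbove (m ∸ i) i) (extend-nonC (w i) (runBelow i) wᵢ≢C)

  runAbove-nonC : ∀ n i → w i ≢ C → runAbove n i ≡ 0
  runAbove-nonC zero    i _    = refl
  runAbove-nonC (suc n) i wᵢ≢C = extend-nonC (w i) (runAbove n (suc i)) wᵢ≢C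

  cValue-left : ∀ i → i ℕ.< m → cValue i ≡ runBelow i ℕ.* suc (runAbove (m ∸ i) i)
  cValue-left zero    _     = refl
  cValue-left (suc i) 1+i<m with w i ≟ᶠ C
  ... | yes wᵢ≡C = trans (cong (runBelow (suc i) ℕ.*_) (runAbove-step i (ℕP.<-trans (ℕP.n<1+n i) 1+i<m)))
                         (cong (λ f → runBelow (suc i) ℕ.* extend f (runAbove (m ∸ suc i) (suc i))) wᵢ≡C)
  ... | no wᵢ≢C  = trans (cong (ℕ._* runAbove (m ∸ i) i) (extend-nonC (w i) (runBelow i) wᵢ≢C))
                         (sym (cong (ℕ._* suc (runAbove (m ∸ suc i) (suc i))) (extend-nonC (w i) (runBelow i) wᵢ≢C)))

  cValue-right : ∀ i → cValue (suc (suc i)) ≡ suc (runBelow (suc i)) ℕ.* runAbove (m ∸ suc i) (suc i)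
  cValue-right i with w (suc i) ≟ᶠ C
  ... | yes w₁₊ᵢ≡C = cong (λ f → extend f (runBelow (suc i)) ℕ.* runAbove (m ∸ suc i) (suc i)) w₁₊ᵢ≡C
  ... | no w₁₊ᵢ≢C  = trans (cong (ℕ._* runAbove (m ∸ suc i) (suc i)) (extend-nonC (w (suc i)) (runBelow (suc i)) w₁₊ᵢ≢C))
                           (sym (trans (cong (suc (runBelow (suc i)) ℕ.*_) (runAbove-nonC (m ∸ suc i) (suc i) w₁₊ᵢ≢C))
                                       (ℕP.*-zeroʳ (suc (runBelow (suc i))))))

  cValue-run : ∀ i → i ℕ.< m → w i ≡ C → cValue i ℕ.+ cValue (suc (suc i)) ℕ.+ 2 ≡ cValue (suc i) ℕ.+ cValue (suc i)
  cValue-run i i<m wᵢ≡C = begin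
    cValue i ℕ.+ cValue (suc (suc i)) ℕ.+ 2
      ≡⟨ cong₂ (λ a b → a ℕ.+ b ℕ.+ 2) (trans (cValue-left i i<m) (cong (λ a → P ℕ.* suc a) runAboveᵢ))
                                       (trans (cValue-right i) (cong (λ a → suc a ℕ.* Q) runBelowᵢ)) ⟩
    P ℕ.* suc (suc Q) ℕ.+ suc (suc P) ℕ.* Q ℕ.+ 2
      ≡⟨ run-identity P Q ⟩
    suc P ℕ.* suc Q ℕ.+ suc P ℕ.* suc Q
      ≡⟨ cong (λ a → a ℕ.+ a) (sym (cong₂ ℕ._*_ runBelowᵢ runAboveᵢ)) ⟩
    cValue (suc i) ℕ.+ cValue (suc i) ∎
    where
    open ≡-Reasoning
    P = runBelow i
    Q = runAbove (m ∸ suc i) (suc i)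
    runBelowᵢ : runBelow (suc i) ≡ suc P
    runBelowᵢ = cong (λ f → extend f P) wᵢ≡C
    runAboveᵢ : runAbove (m ∸ i) i ≡ suc Q
    runAboveᵢ = trans (runAbove-step i i<m) (cong (λ f → extend f Q) wᵢ≡C)

  -- In an A- or B-triple C_{i+1} = 0, so 2 − A − B = −C_i − C_{i+2} fixes the remaining slack.
  freeValue : Family → ℕ → ℕ
  freeValue A i = 2 ℕ.+ cValue i ℕ.+ cValue (suc (suc i))
  freeValue B i = 2 ℕ.+ cValue i ℕ.+ cValue (suc (suc i))
  freeValue C i = cValue (suc i)

  slackValue : Family → ℕ → ℕ
  slackValue f i = only f (w i) (freeValue f i)

  cValue-recurrence : ∀ i → i ℕ.< m →
    cValue i ℕ.+ cValue (suc (suc i)) ℕ.+ 2 ≡ cValue (suc i) ℕ.+ cValue (suc i) ℕ.+ slackValue A i ℕ.+ slackValue B i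
  cValue-recurrence i i<m = at-letter (w i) refl
    where
    c₀ = cValue i
    c₂ = cValue (suc (suc i))
    at-letter : ∀ l → w i ≡ l →
      c₀ ℕ.+ c₂ ℕ.+ 2 ≡ cValue (suc i) ℕ.+ cValue (suc i) ℕ.+ only A l (freeValue A i) ℕ.+ only B l (freeValue B i)
    at-letter A wᵢ≡A rewrite cValue-nonC i (λ wᵢ≡C → case (trans (sym wᵢ≡A) wᵢ≡C) of λ ()) =
      trans (ℕP.+-comm (c₀ ℕ.+ c₂) 2) (sym (ℕP.+-identityʳ (2 ℕ.+ c₀ ℕ.+ c₂)))
    at-letter B wᵢ≡B rewrite cValue-nonC i (λ wᵢ≡C → case (trans (sym wᵢ≡B) wᵢ≡C) of λ ()) =
      ℕP.+-comm (c₀ ℕ.+ c₂) 2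
    at-letter C wᵢ≡C = trans (cValue-run i i<m wᵢ≡C) (sym (trans (ℕP.+-identityʳ _) (ℕP.+-identityʳ _)))

  cValue≡slackValue-C : ∀ i → cValue (suc i) ≡ slackValue C i
  cValue≡slackValue-C i with w i ≟ᶠ C
  ... | yes wᵢ≡C = cong (λ l → only C l (cValue (suc i))) (sym wᵢ≡C)
  ... | no wᵢ≢C  = trans (cValue-nonC i wᵢ≢C) (sym (only-≢ C (w i) (cValue (suc i)) (wᵢ≢C ∘ sym)))

  decode-slackValues : ∀ i → decode (slackValue A i) (slackValue B i) ≡ w i
  decode-slackValues i = at-letter (w i) refl
    where
    at-letter : ∀ l → w i ≡ l → decode (only A l (freeValue A i)) (only B l (freeValue B i)) ≡ w i
    at-letter A wᵢ≡l = sym wᵢ≡l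
    at-letter B wᵢ≡l = sym wᵢ≡l
    at-letter C wᵢ≡l = sym wᵢ≡l

  xValue yValue : ℕ → ℕ
  xValue = tailSum m (λ l → slackValue A (m ∸ l))
  yValue = tailSum m (λ l → slackValue B (l ∸ 1))

  -- z is read off C_1 = z + m − y_1.
  vertex : Point m
  vertex = (λ k → ι (xValue (suc (toℕ k)))) , (λ k → ι (yValue (suc (toℕ k)))) ,
           ιℤ (+ (cValue 1 ℕ.+ yValue 1) ℤ.- + m)

  Z-vertex : Z vertex ≡ ι (cValue 1 ℕ.+ yValue 1) - ι m
  Z-vertex = trans (ιℤ-+ (+ (cValue 1 ℕ.+ yValue 1)) (ℤ.- + m)) (cong (_+_ (ι (cValue 1 ℕ.+ yValue 1))) (ιℤ-neg (+ m)))

  slackA-vertex : ∀ i → i ℕ.< m → slack A vertex i ≡ ι (slackValue A i)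
  slackA-vertex i i<m = trans
    (∀<-suc⇒∀<-∸ (λ k → decrement (X vertex) k ≡ ι (slackValue A (m ∸ k))) m
                 (λ k → decrement-tailSum m (λ l → slackValue A (m ∸ l))) i i<m)
    (cong (λ j → ι (slackValue A j)) (ℕP.m∸[m∸n]≡n (ℕP.<⇒≤ i<m)))

  slackB-vertex : ∀ i → i ℕ.< m → slack B vertex i ≡ ι (slackValue B i)
  slackB-vertex i = decrement-tailSum m (λ l → slackValue B (l ∸ 1))

  cForm-vertex : ∀ j → j ℕ.≤ suc m → cForm vertex j ≡ ι (cValue j)
  cForm-vertex = secondDiff-unique (cForm vertex) (ι ∘ cValue) (cForm-zero vertex) cForm₁ λ i i<m → begin
    secondDiff (cForm vertex) i                         ≡⟨ secondDiff-cForm vertex i i<m ⟩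
    (1ℚ + 1ℚ) - slack A vertex i - slack B vertex i     ≡⟨ cong₂ (λ a b → (1ℚ + 1ℚ) - a - b) (slackA-vertex i i<m) (slackB-vertex i i<m) ⟩
    (1ℚ + 1ℚ) - ι (slackValue A i) - ι (slackValue B i) ≡⟨ sym (ι-secondDiff cValue i _ _ (cValue-recurrence i i<m)) ⟩
    secondDiff (ι ∘ cValue) i                           ∎
    where
    open ≡-Reasoning
    cForm₁ : cForm vertex 1 ≡ ι (cValue 1)
    cForm₁ = begin
      cForm vertex 1                                       ≡⟨ cForm-one vertex ⟩
      (Z vertex + ι m) - Y vertex 1                        ≡⟨ cong₂ (λ z y → (z + ι m) - y) Z-vertex (at-tailSum m _ z≤n) ⟩
      ((ι (cValue 1 ℕ.+ yValue 1) - ι m) + ι m) - ι (yValue 1)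
        ≡⟨ cong (_- ι (yValue 1)) (solve 2 (λ a b → (a :- b) :+ b := a) refl (ι (cValue 1 ℕ.+ yValue 1)) (ι m)) ⟩
      ι (cValue 1 ℕ.+ yValue 1) - ι (yValue 1)             ≡⟨ ι-+-cancelʳ (cValue 1) (yValue 1) ⟩
      ι (cValue 1)                                         ∎

  slack-vertex : ∀ f i → i ℕ.< m → slack f vertex i ≡ ι (slackValue f i)
  slack-vertex A i i<m = slackA-vertex i i<m
  slack-vertex B i i<m = slackB-vertex i i<m
  slack-vertex C i i<m = trans (cForm-vertex (suc i) (s≤s (ℕP.<⇒≤ i<m))) (cong ι (cValue≡slackValue-C i))

  vertex-feasible : Feasible vertex
  vertex-feasible = trans (cForm-vertex (suc m) ℕP.≤-refl) (cong ι cValue-top) ,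
                    λ f i i<m → subst (0ℚ ℚ.≤_) (sym (slack-vertex f i i<m)) (0≤ι (slackValue f i))

  vertex-tight : Tight w vertex
  vertex-tight f i i<m f≢wᵢ = trans (slack-vertex f i i<m) (cong ι (only-≢ f (w i) (freeValue f i) f≢wᵢ))

  vertex-isVertex : IsVertex (suc (suc m)) vertex
  vertex-isVertex = tight-feasible⇒vertex w vertex-feasible vertex-tight

  vertex-integral : Integral vertex
  vertex-integral = (λ k → + xValue (suc (toℕ k)) , refl) , (λ k → + yValue (suc (toℕ k)) , refl) ,
                    (+ (cValue 1 ℕ.+ yValue 1) ℤ.- + m , refl)

-- Counting the vertices

families-unique : Unique families
families-unique = ((λ ()) All.∷ (λ ()) All.∷ All.[]) ∷ ((λ ()) All.∷ All.[]) ∷ All.[] ∷ []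

words : ∀ n → List (Vec Family n)
words zero    = [] ∷ []
words (suc n) = cartesianProductWith _∷_ families (words n)

length-cartesianProductWith : ∀ {A B C : Set} (f : A → B → C) xs ys →
  length (cartesianProductWith f xs ys) ≡ length xs ℕ.* length ys
length-cartesianProductWith f []       ys = refl
length-cartesianProductWith f (x ∷ xs) ys = trans (ListP.length-++ (map (f x) ys))
  (cong₂ ℕ._+_ (ListP.length-map (f x) ys) (length-cartesianProductWith f xs ys))

length-words : ∀ n → length (words n) ≡ 3 ^ n
length-words zero    = refl
length-words (suc n) = trans (length-cartesianProductWith _∷_ families (words n)) (cong (3 ℕ.*_) (length-words n))

words-unique : ∀ n → Unique (words n)
words-unique zero    = All.[] ∷ []
words-unique (suc n) = Unique.cartesianProductWith⁺ _∷_ VecP.∷-injective families-unique (words-unique n)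

∈-words : ∀ {n} (w : Vec Family n) → w ∈ words n
∈-words []      = here refl
∈-words (f ∷ w) = ∈-cartesianProductWith⁺ _∷_ (∈-families f) (∈-words w)

_‼_ : ∀ {n} → Vec Family n → ℕ → Family
[]      ‼ _     = A
(f ∷ w) ‼ zero  = f
(f ∷ w) ‼ suc i = w ‼ i

fromFunction : ∀ n → (ℕ → Family) → Vec Family n
fromFunction zero    g = []
fromFunction (suc n) g = g 0 ∷ fromFunction n (g ∘ suc)

fromFunction-‼ : ∀ n g {i} → i ℕ.< n → fromFunction n g ‼ i ≡ g i
fromFunction-‼ (suc n) g {zero}  _         = refl
fromFunction-‼ (suc n) g {suc i} (s≤s i<n) = fromFunction-‼ n (g ∘ suc) i<n

‼-injective : ∀ {n} (u v : Vec Family n) → (∀ i → i ℕ.< n → u ‼ i ≡ v ‼ i) → u ≡ v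
‼-injective []      []      _  = refl
‼-injective (f ∷ u) (g ∷ v) u≡v = cong₂ _∷_ (u≡v 0 (s≤s z≤n)) (‼-injective u v (λ i i<n → u≡v (suc i) (s≤s i<n)))

Distinct-map : ∀ {m} {W : Set} (F : W → Point m) → (∀ {u v} → F u ≈P F v → u ≡ v) →
               ∀ {ws} → Unique ws → Distinct (map F ws)
Distinct-map F F-injective {[]}     []              = []
Distinct-map F F-injective {w ∷ ws} (w∉ws ∷ unique) = fresh ∷ Distinct-map F F-injective unique
  where
  fresh : ∀ {q} → q ∈ map F ws → ¬ (F w ≈P q)
  fresh q∈ Fw≈q with ∈-map⁻ F q∈
  ... | u , u∈ws , refl = All.lookup w∉ws u∈ws (F-injective Fw≈q)

module Vertices (m : ℕ) where
  open Polytope m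

  vertexOf : Vec Family m → Point m
  vertexOf w = Vertex.vertex m (w ‼_)

  vertexOf-injective : ∀ {u v} → vertexOf u ≈P vertexOf v → u ≡ v
  vertexOf-injective {u} {v} u≈v = ‼-injective u v λ i i<m → begin
    u ‼ i                                                  ≡⟨ sym (U.decode-slackValues i) ⟩
    decode (U.slackValue A i) (U.slackValue B i)           ≡⟨ cong₂ decode (same-slackValue A i i<m) (same-slackValue B i i<m) ⟩
    decode (V.slackValue A i) (V.slackValue B i)           ≡⟨ V.decode-slackValues i ⟩
    v ‼ i                                                  ∎
    where
    open ≡-Reasoning
    module U = Vertex m (u ‼_)
    module V = Vertex m (v ‼_)
    same-slackValue : ∀ f i → i ℕ.< m → U.slackValue f i ≡ V.slackValue f i
    same-slackValue f i i<m = ι-injective (begin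
      ι (U.slackValue f i)       ≡⟨ sym (U.slack-vertex f i i<m) ⟩
      slack f (vertexOf u) i     ≡⟨ resp-≈P (affine-slack f i) u≈v ⟩
      slack f (vertexOf v) i     ≡⟨ V.slack-vertex f i i<m ⟩
      ι (V.slackValue f i)       ∎)

  ≈P-vertexOf-letters : ∀ {p} → IsVertex (suc (suc m)) p → p ≈P vertexOf (fromFunction m (letter p))
  ≈P-vertexOf-letters {p} p-vertex = vertex-≈P-by-support p-vertex V.vertex-feasible support
    where
    w = fromFunction m (letter p)
    module V = Vertex m (w ‼_)
    support : ∀ f i → i ℕ.< m → slack f p i ≡ 0ℚ → slack f (vertexOf w) i ≡ 0ℚ
    support f i i<m slackᵢ≡0 = by-cases (f ≟ᶠ (w ‼ i))
      where
      by-cases : Dec (f ≡ w ‼ i) → slack f (vertexOf w) i ≡ 0ℚ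
      by-cases (yes f≡wᵢ) = ⊥-elim (slack-letter≢0 (InP⇒Feasible p (proj₁ p-vertex)) i i<m
                              (subst (λ g → slack g p i ≡ 0ℚ) (trans f≡wᵢ (fromFunction-‼ m (letter p) i<m)) slackᵢ≡0))
      by-cases (no f≢wᵢ)  = V.vertex-tight f i i<m f≢wᵢ

  vertices : List (Point m)
  vertices = map vertexOf (words m)

  polytope : IntegralPolytopeWithVertices (suc (suc m)) (3 ^ m)
  polytope = bounded , vertices ,
    trans (ListP.length-map vertexOf (words m)) (length-words m) ,
    Distinct-map vertexOf vertexOf-injective (words-unique m) ,
    (λ p∈ → case ∈-map⁻ vertexOf p∈ of λ where
      (w , _ , refl) → Vertex.vertex-isVertex m (w ‼_) , Vertex.vertex-integral m (w ‼_)) ,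
    λ p p-vertex → Any.map (λ e → subst (p ≈P_) e (≈P-vertexOf-letters p-vertex))
                           (∈-map⁺ vertexOf (∈-words (fromFunction m (letter p))))

theorem5p20 : (d : ℕ) → 3 ℕ.≤ d → IntegralPolytopeWithVertices d (3 ^ (d ∸ 2))
theorem5p20 (suc (suc m)) (s≤s (s≤s _)) = Vertices.polytope m
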